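{- Let $C$ be a smooth projective curve of genus $2$ defined over $\mathbb{Q}$ which has exactly four $\mathbb{Q}$-rational Weierstrass points. If $C$ is described by a globally minimal Weierstrass equation of the form $E: y^2+Q(x)y=P(x)$ with $P,Q\in\mathbb{Z}[x]$, $\deg Q(x)\le 2$ and $P(x)$ monic of degree $5$, then $|\Delta_E|$ is never an odd prime.
   Context: For a Weierstrass equation $E: y^2+Q(x)y=P(x)$ of a genus $2$ curve over $\mathbb{Q}$, its discriminant is $\Delta_E=2^{ -12}\operatorname{disc}(4P(x)+Q(x)^2)$. An integral Weierstrass equation (coefficients in $\mathbb{Z}$) is minimal at a prime $p$ if the $p$-adic valuation of its discriminant is smallest among all integral Weierstrass equations over $\mathbb{Z}_p$ describing the curve, and globally minimal if it is minimal at every prime. A Weierstrass point is a fixed point of the hyperelliptic involution. -}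

module Defs where

open import Data.Nat as ℕ using (ℕ; zero; suc)
open import Data.Nat.Divisibility using (_∣_)
open import Data.Integer as ℤ using (ℤ; +_)
open import Data.Rational as ℚ using (ℚ; 0ℚ; 1ℚ; _+_; _*_; -_; _/_; 1/_; ≢-nonZero)
open import Data.Fin as Fin using (Fin; toℕ)
open import Data.Vec as Vec using (Vec)
open import Data.List as List using (List; []; _∷_; _++_)
open import Data.List.Relation.Unary.All using (All)
open import Data.Bool using (true; false)
open import Data.Unit using (⊤)
open import Data.Maybe using (Maybe; just; nothing)
open import Data.Product using (_×_; _,_; Σ; ∃)
open import Relation.Binary.PropositionalEquality using (_≡_; _≢_)
open import Relation.Nullary using (¬_)

-- Polynomials over ℚ as coefficient lists, constant term first.

Poly : Set
Poly = List ℚ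

_⊕_ : Poly → Poly → Poly
[] ⊕ g = g
(a ∷ f) ⊕ [] = a ∷ f
(a ∷ f) ⊕ (b ∷ g) = (a + b) ∷ (f ⊕ g)

scale : ℚ → Poly → Poly
scale c = List.map (c *_)

_⊗_ : Poly → Poly → Poly
[] ⊗ g = []
(a ∷ f) ⊗ g = scale a g ⊕ (0ℚ ∷ (f ⊗ g))

_⊖_ : Poly → Poly → Poly
f ⊖ g = f ⊕ scale (- 1ℚ) g

pow : Poly → ℕ → Poly
pow f zero = 1ℚ ∷ []
pow f (suc n) = f ⊗ pow f n

eval : Poly → ℚ → ℚ
eval f x = List.foldr (λ c acc → c + x * acc) 0ℚ f

coeff : Poly → ℕ → ℚ
coeff [] i = 0ℚ
coeff (a ∷ f) zero = a
coeff (a ∷ f) (suc i) = coeff f i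

-- Homogenised substitution of degree n:
--   F ↦ Σ_i f_i (a x + b)^i (c x + d)^(n - i)
--   i.e. (c x + d)^n F((a x + b)/(c x + d)) for F viewed as a form of degree n.
substForm : ℕ → ℚ → ℚ → ℚ → ℚ → Poly → Poly
substForm n a b c d F = go 0 F
  where
  go : ℕ → Poly → Poly
  go i [] = []
  go i (f ∷ fs) =
    scale f (pow (b ∷ a ∷ []) i ⊗ pow (d ∷ c ∷ []) (n ℕ.∸ i)) ⊕ go (suc i) fs

det : (n : ℕ) → (Fin n → Fin n → ℚ) → ℚ
det zero M = 1ℚ
det (suc n) M = go n (λ j → j) 0ℚ 1ℚ
  where
  minor : Fin (suc n) → Fin n → Fin n → ℚ
  minor j r s = M (Fin.suc r) (Fin.punchIn j s)
  go : (k : ℕ) → (Fin (suc k) → Fin (suc n)) → ℚ → ℚ → ℚ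
  go zero col acc sgn = acc + sgn * M Fin.zero (col Fin.zero) * det n (minor (col Fin.zero))
  go (suc k) col acc sgn =
    go k (λ t → col (Fin.suc t))
       (acc + sgn * M Fin.zero (col Fin.zero) * det n (minor (col Fin.zero)))
       (- sgn)

-- Sylvester matrix of two binary forms of degree m, given by
-- coefficient functions f, g : ℕ → ℚ where f i is the coefficient of X^i Z^(m-i).
-- Rows 0..m-1 hold shifts of f, rows m..2m-1 hold shifts of g,
-- coefficients written from X^m down to Z^m.
sylvester : (m : ℕ) → (ℕ → ℚ) → (ℕ → ℚ) → Fin (m ℕ.+ m) → Fin (m ℕ.+ m) → ℚ
sylvester m f g r s = entry (toℕ r) (toℕ s)
  where
  at : (ℕ → ℚ) → ℕ → ℕ → ℚ
  at h k s with s ℕ.<ᵇ k | (s ℕ.∸ k) ℕ.≤ᵇ m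
  ... | true  | _     = 0ℚ
  ... | false | true  = h (m ℕ.∸ (s ℕ.∸ k))
  ... | false | false = 0ℚ
  entry : ℕ → ℕ → ℚ
  entry r s with r ℕ.<ᵇ m
  ... | true  = at f r s
  ... | false = at g (r ℕ.∸ m) s

resultantForms : (m : ℕ) → (ℕ → ℚ) → (ℕ → ℚ) → ℚ
resultantForms m f g = det (m ℕ.+ m) (sylvester m f g)

-- Discriminant of a binary sextic F = Σ_{i ≤ 6} a_i X^i Z^(6-i)
-- (a_6 may vanish).  Uses disc(F) = - 6^(-4) Res(∂F/∂X, ∂F/∂Z), which agrees
-- with the usual a_6^10 ∏(r_i - r_j)^2 and equals a_5^2 disc_5 when a_6 = 0.
discSextic : Poly → ℚ
discSextic F =
  - ((+ 1 / 1296) * resultantForms 5 FX FZ)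
  where
  a : ℕ → ℚ
  a = coeff F
  FX : ℕ → ℚ
  FX j = (+ (suc j) / 1) * a (suc j)
  FZ : ℕ → ℚ
  FZ j = (+ (6 ℕ.∸ j) / 1) * a j

-- Genus 2 Weierstrass equations  y^2 + Q(x) y = P(x),
-- deg Q ≤ 3, deg P ≤ 6, with coefficients in ℚ.

record WEq : Set where
  constructor weq
  field
    P : Poly
    Q : Poly

Δ : WEq → ℚ
Δ (weq P Q) = (+ 1 / 4096) * discSextic (scale (+ 4 / 1) P ⊕ (Q ⊗ Q))

-- Changes of variables between Weierstrass equations of the same genus 2
-- curve:  x = (a x' + b)/(c x' + d),  y = (e y' + H(x'))/(c x' + d)^3,
-- with ad - bc ≠ 0, e ≠ 0, deg H ≤ 3.
record Transf : Set where
  field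
    a b c d e : ℚ
    H : Vec ℚ 4
    det≢0 : a * d + - (b * c) ≢ 0ℚ
    e≢0 : e ≢ 0ℚ

transform : Transf → WEq → WEq
transform t (weq P Q) = weq P' Q'
  where
  open Transf t
  e⁻¹ : ℚ
  e⁻¹ = 1/_ e {{≢-nonZero e≢0}}
  h : Poly
  h = Vec.toList H
  Q̃ P̃ : Poly
  Q̃ = substForm 3 a b c d Q
  P̃ = substForm 6 a b c d P
  Q' P' : Poly
  Q' = scale e⁻¹ (scale (+ 2 / 1) h ⊕ Q̃)
  P' = scale (e⁻¹ * e⁻¹) ((P̃ ⊖ (h ⊗ h)) ⊖ (Q̃ ⊗ h))

IsPIntegral : ℕ → ℚ → Set
IsPIntegral p q = ¬ (p ∣ ℚ.denominatorℕ q)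

PIntegralEq : ℕ → WEq → Set
PIntegralEq p (weq P Q) = All (IsPIntegral p) P × All (IsPIntegral p) Q

-- v_p(Δ E) ≤ v_p(Δ E')  (for Δ E ≠ 0): Δ E' / Δ E is p-integral
ValLe : ℕ → ℚ → ℚ → Set
ValLe p x y = Σ ℚ (λ r → IsPIntegral p r × y ≡ r * x)

MinimalAt : ℕ → WEq → Set
MinimalAt p E = (t : Transf) → PIntegralEq p (transform t E) →
                ValLe p (Δ E) (Δ (transform t E))

toℚ : ℤ → ℚ
toℚ z = z / 1

Pmonic5 : Vec ℤ 5 → Poly
Pmonic5 p = List.map toℚ (Vec.toList p) ++ (1ℚ ∷ [])

Qdeg2 : Vec ℤ 3 → Poly
Qdeg2 q = List.map toℚ (Vec.toList q)

eqn : Vec ℤ 5 → Vec ℤ 3 → WEq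
eqn p q = weq (Pmonic5 p) (Qdeg2 q)

-- Rational points of the smooth projective curve given by E (with deg P = 5,
-- deg Q ≤ 2 there is exactly one point at infinity, rational, encoded as
-- 'nothing'); affine points are 'just (x , y)'.

Pt : Set
Pt = Maybe (ℚ × ℚ)

IsRatPoint : WEq → Pt → Set
IsRatPoint E nothing = ⊤
IsRatPoint (weq P Q) (just (x , y)) = y * y + eval Q x * y ≡ eval P x

ι : WEq → Pt → Pt
ι E nothing = nothing
ι (weq P Q) (just (x , y)) = just (x , - y + - eval Q x)

IsWeierstrassPt : WEq → Pt → Set
IsWeierstrassPt E pt = IsRatPoint E pt × ι E pt ≡ pt

ExactlyFourRatWP : WEq → Set
ExactlyFourRatWP E =
  Σ (Vec Pt 4) λ w →
    (∀ i j → Vec.lookup w i ≡ Vec.lookup w j → i ≡ j) ×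
    (∀ pt → IsWeierstrassPt E pt → ∃ λ i → Vec.lookup w i ≡ pt) ×
    (∀ i → IsWeierstrassPt E (Vec.lookup w i))

-- Put f = 4P + Q², a quintic with disc f = 256 Δ, and let a, b, c be its three rational roots; the
-- fourth rational Weierstrass point is the one at infinity.  The integers 4a, 4b, 4c are roots of the
-- monic polynomial 4⁴ f(x / 4), and the squares of their differences divide 2³² Δ.  If |Δ| were an odd
-- prime, these differences would be powers of two up to sign; as they add up to zero, one root would be
-- the midpoint b of the two others, b ± s.  Parity then shows that a, b, c are integers: a divided
-- difference rules out two odd roots, and an even root of the monic polynomial is divisible by 4.  Finally
--   f = 4(x - b - s)(x - b)(x - b + s)(x² + …)  and  f ≡ Q²  (mod 4)
-- force Δ to be even, whether s is even or odd.
module Submission where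

open import Defs
open import Algebra.Solver.Ring.AlmostCommutativeRing using (fromCommutativeRing; _-Raw-AlmostCommutative⟶_)
import Algebra.Solver.Ring as RingSolver
open import Data.Bool using (Bool; true; false; if_then_else_)
open import Data.Empty using (⊥; ⊥-elim)
open import Data.Fin as Fin using (Fin; zero; suc; punchIn; toℕ)
open import Data.Fin.Patterns
open import Data.Fin.Properties using (_≟_)
open import Data.Integer as ℤ using (ℤ; +_; -[1+_])
open import Data.Integer.DivMod using (a≡a%ℕn+[a/ℕn]*n; n%ℕd<d; _%ℕ_; _/ℕ_)
import Data.Integer.Properties as ℤ
open import Data.List as List using (List; []; _∷_)
open import Data.Maybe as Maybe using (Maybe; just; nothing; is-just)
open import Data.Maybe.Properties using (just-injective)
open import Data.Nat as ℕ using (ℕ; zero; suc; s≤s; _^_; NonZero)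
open import Data.Nat.Coprimality as Coprimality using (Coprime; coprime-divisor)
open import Data.Nat.Divisibility using (_∣_; _∤_; divides; _∣?_; ∣-trans; m∣m*n; n∣m*n; ∣m+n∣m⇒∣n; ∣1⇒≡1; *-pres-∣)
open import Data.Nat.Induction using (<-wellFounded)
open import Data.Nat.Primality using (Prime; prime⇒irreducible; euclidsLemma; prime[2]; ¬prime[1])
import Data.Nat.Properties as ℕ
open import Data.Product using (Σ; ∃; _×_; _,_; proj₁; proj₂)
open import Data.Rational as ℚ using (ℚ; mkℚ; 0ℚ; 1ℚ; _+_; _*_; -_; _/_; 1/_; ≢-nonZero; toℚᵘ)
import Data.Rational.Properties as ℚ
open import Data.Rational.Unnormalised as ℚᵘ using (mkℚᵘ; *≡*)
import Data.Rational.Unnormalised.Properties as ℚᵘ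
open import Data.Sum using (_⊎_; inj₁; inj₂)
open import Data.Vec as Vec using (Vec; []; _∷_)
open import Data.Vec.Properties using (lookup-map)
open import Relation.Binary.HeterogeneousEquality.Core using (_≅_; refl)
open import Relation.Binary.PropositionalEquality
open import Relation.Nullary using (¬_; yes; no)
open import Relation.Nullary.Decidable using (dec⇒maybe; toWitnessFalse; False)
open import Tactic.Cong using (cong!)

-- Determinants of polynomial matrices

-- That disc f = 256 Δ is a product over roots has to be computed, as Δ is defined by the Laplace
-- expansion of a 10 by 10 Sylvester determinant. This determinant is evaluated symbolically, once,
-- for (x³ - σx² + τx - π)(4x² + ux + v): five symmetric parameters give far smaller normal forms
-- than the roots, and dividing f by its three rational linear factors brings it into this shape.
-- The exponent 32 is 8 + 24: disc f = 2⁸ Δ, and making f monic by x ↦ x / 4 multiplies the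
-- discriminant by 4²⁰ / 4⁸ = 2²⁴. The midpoint comes from 2^i + 2^j = 2^k, which forces i = j.
-- Integrality of the midpoint b matters because f(b + x) is then again of the form 4P + Q² with
-- integral P and Q, so that congruences modulo 4 restrict its coefficients.

toℚᵘ-toℚ : ∀ i → toℚᵘ (toℚ i) ℚᵘ.≃ mkℚᵘ i 0
toℚᵘ-toℚ i = ℚ.toℚᵘ-fromℚᵘ (mkℚᵘ i 0)

toℚ-+ : ∀ i j → toℚ (i ℤ.+ j) ≡ toℚ i + toℚ j
toℚ-+ i j = ℚ.toℚᵘ-injective (begin
  toℚᵘ (toℚ (i ℤ.+ j))            ≈⟨ toℚᵘ-toℚ (i ℤ.+ j) ⟩
  mkℚᵘ (i ℤ.+ j) 0                ≈⟨ *≡* (cong (ℤ._* + 1) (cong₂ ℤ._+_ (sym (ℤ.*-identityʳ i)) (sym (ℤ.*-identityʳ j)))) ⟩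
  mkℚᵘ i 0 ℚᵘ.+ mkℚᵘ j 0          ≈⟨ ℚᵘ.+-cong (ℚᵘ.≃-sym (toℚᵘ-toℚ i)) (ℚᵘ.≃-sym (toℚᵘ-toℚ j)) ⟩
  toℚᵘ (toℚ i) ℚᵘ.+ toℚᵘ (toℚ j)  ≈⟨ ℚᵘ.≃-sym (ℚ.toℚᵘ-homo-+ (toℚ i) (toℚ j)) ⟩
  toℚᵘ (toℚ i + toℚ j)            ∎)
  where open ℚᵘ.≃-Reasoning

toℚ-* : ∀ i j → toℚ (i ℤ.* j) ≡ toℚ i * toℚ j
toℚ-* i j = ℚ.toℚᵘ-injective (begin
  toℚᵘ (toℚ (i ℤ.* j))            ≈⟨ toℚᵘ-toℚ (i ℤ.* j) ⟩
  mkℚᵘ i 0 ℚᵘ.* mkℚᵘ j 0          ≈⟨ ℚᵘ.*-cong (ℚᵘ.≃-sym (toℚᵘ-toℚ i)) (ℚᵘ.≃-sym (toℚᵘ-toℚ j)) ⟩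
  toℚᵘ (toℚ i) ℚᵘ.* toℚᵘ (toℚ j)  ≈⟨ ℚᵘ.≃-sym (ℚ.toℚᵘ-homo-* (toℚ i) (toℚ j)) ⟩
  toℚᵘ (toℚ i * toℚ j)            ∎)
  where open ℚᵘ.≃-Reasoning

toℚ-neg : ∀ i → toℚ (ℤ.- i) ≡ - toℚ i
toℚ-neg i = ℚ.toℚᵘ-injective (begin
  toℚᵘ (toℚ (ℤ.- i))  ≈⟨ toℚᵘ-toℚ (ℤ.- i) ⟩
  ℚᵘ.- mkℚᵘ i 0       ≈⟨ ℚᵘ.-‿cong (ℚᵘ.≃-sym (toℚᵘ-toℚ i)) ⟩
  ℚᵘ.- toℚᵘ (toℚ i)   ≈⟨ ℚᵘ.≃-sym (ℚ.toℚᵘ-homo‿- (toℚ i)) ⟩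
  toℚᵘ (- toℚ i)      ∎)
  where open ℚᵘ.≃-Reasoning

toℚ-injective : ∀ {i j} → toℚ i ≡ toℚ j → i ≡ j
toℚ-injective {i} {j} eq with ℚᵘ.≃-trans (ℚᵘ.≃-sym (toℚᵘ-toℚ i)) (ℚᵘ.≃-trans (ℚ.toℚᵘ-cong eq) (toℚᵘ-toℚ j))
... | *≡* i*1≡j*1 = ℤ.*-cancelʳ-≡ i j (+ 1) i*1≡j*1

toℚ-morphism : ℤ.+-*-rawRing -Raw-AlmostCommutative⟶ fromCommutativeRing ℚ.+-*-commutativeRing
toℚ-morphism = record
  { ⟦_⟧ = toℚ ; +-homo = toℚ-+ ; *-homo = toℚ-* ; -‿homo = toℚ-neg ; 0-homo = refl ; 1-homo = refl }

-- Integer coefficients keep fractions out of the normal forms and allow the same syntax to be read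
-- in ℤ.
module S = RingSolver ℤ.+-*-rawRing (fromCommutativeRing ℚ.+-*-commutativeRing) toℚ-morphism
  (λ i j → Maybe.map (cong toℚ) (dec⇒maybe (i ℤ.≟ j)))
open S using (Polynomial; con; var; op; _:+_; _:*_; _:-_; :-_; _:^_; ⟦_⟧; normalise; _≟N_)

-- The hypothesis is a closed Boolean computation that does not mention ρ; checking it by `refl`
-- compares normal forms only and evaluates nothing in ℚ.
polynomial-identity : ∀ {n} (p q : Polynomial n) → is-just (normalise p ≟N normalise q) ≡ true → ∀ ρ → ⟦ p ⟧ ρ ≡ ⟦ q ⟧ ρ
polynomial-identity p q eq ρ = trans (sym (S.correct p ρ)) (trans (S.⟦ same (normalise p ≟N normalise q) eq ⟧N-cong ρ) (S.correct q ρ))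
  where
  same : ∀ {A : Set} (x : Maybe A) → is-just x ≡ true → A
  same (just x) _ = x

Matrix : Set → ℕ → Set
Matrix A n = Fin n → Fin n → A

minor : ∀ {A n} → Matrix A (suc n) → Fin (suc n) → Matrix A n
minor M j r s = M (suc r) (punchIn j s)

-- The local function `go` of `det` cannot be named, but the unifier finds it: after abstracting
-- two unfolding steps of `det`, it stands applied to distinct variables.
mutual
  laplace : ∀ n → Matrix ℚ (suc n) → ∀ k → (Fin (suc k) → Fin (suc n)) → ℚ → ℚ → ℚ
  laplace n M k col acc sgn = _

  det-laplace : ∀ k (M : Matrix ℚ (suc (suc (suc k)))) →
    det (suc (suc (suc k))) M ≡
      laplace (suc (suc k)) M k (λ t → suc (suc t))
        (0ℚ + 1ℚ * M zero zero * det (suc (suc k)) (minor M zero)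
            + (- 1ℚ) * M zero (suc zero) * det (suc (suc k)) (minor M (suc zero)))
        (- (- 1ℚ))
  det-laplace k M with 0ℚ + 1ℚ * M zero zero * det (suc (suc k)) (minor M zero)
                          + (- 1ℚ) * M zero (suc zero) * det (suc (suc k)) (minor M (suc zero))
  ... | acc with - (- 1ℚ) | (λ (t : Fin (suc k)) → Fin.suc (Fin.suc t))
  ... | sgn | col with ℕ.suc (suc k) | M | col
  ... | m | M' | col' = refl

isZero : ∀ {n} → Polynomial n → Bool
isZero (con (+ 0)) = true
isZero _           = false

infixl 8 _⊡_

-- Products are pruned at zero entries, which keeps the expansion of the sparse Sylvester matrix small.
_⊡_ : ∀ {n} → Polynomial n → Polynomial n → Polynomial n
p ⊡ q = if isZero p then con (+ 0) else p :* q

⊡-correct : ∀ {n} (p q : Polynomial n) ρ → ⟦ p ⊡ q ⟧ ρ ≡ ⟦ p ⟧ ρ * ⟦ q ⟧ ρ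
⊡-correct (con (+ 0))      q ρ = sym (ℚ.*-zeroˡ (⟦ q ⟧ ρ))
⊡-correct (con (+ suc _))  q ρ = refl
⊡-correct (con -[1+ _ ])   q ρ = refl
⊡-correct (op _ _ _)       q ρ = refl
⊡-correct (var _)          q ρ = refl
⊡-correct (_ :^ _)         q ρ = refl
⊡-correct (:- _)           q ρ = refl

mutual
  detₚ : ∀ {m} n → Matrix (Polynomial m) n → Polynomial m
  detₚ zero    M = con (+ 1)
  detₚ (suc n) M = laplaceₚ n M n (λ j → j)

  laplaceₚ : ∀ {m} n → Matrix (Polynomial m) (suc n) → ∀ k → (Fin (suc k) → Fin (suc n)) → Polynomial m
  laplaceₚ n M zero    col = M zero (col zero) ⊡ detₚ n (minor M (col zero))
  laplaceₚ n M (suc k) col = M zero (col zero) ⊡ detₚ n (minor M (col zero)) :- laplaceₚ n M k (λ t → col (suc t))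

module _ {m} (ρ : Vec ℚ m) where
  _≗ₚ_ : ∀ {n} → Matrix ℚ n → Matrix (Polynomial m) n → Set
  M ≗ₚ Mₚ = ∀ r s → M r s ≡ ⟦ Mₚ r s ⟧ ρ

  mutual
    det-correct : ∀ n {M : Matrix ℚ n} {Mₚ} → M ≗ₚ Mₚ → det n M ≡ ⟦ detₚ n Mₚ ⟧ ρ
    det-correct zero    M≗ = refl
    det-correct (suc n) {M} {Mₚ} M≗ = trans (laplace-correct n {Mₚ = Mₚ} M≗ n (λ j → j) 0ℚ 1ℚ)
      (trans (ℚ.+-identityˡ _) (ℚ.*-identityˡ _))

    term-correct : ∀ n {M : Matrix ℚ (suc n)} {Mₚ} → M ≗ₚ Mₚ → ∀ j →
      M zero j * det n (minor M j) ≡ ⟦ Mₚ zero j ⊡ detₚ n (minor Mₚ j) ⟧ ρ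
    term-correct n {Mₚ = Mₚ} M≗ j = trans
      (cong₂ _*_ (M≗ zero j) (det-correct n {Mₚ = minor Mₚ j} (λ r s → M≗ (suc r) (punchIn j s))))
      (sym (⊡-correct (Mₚ zero j) (detₚ n (minor Mₚ j)) ρ))

    -- Accumulator and sign are generalised because `laplace` carries them through its recursion,
    -- whereas `laplaceₚ` subtracts the expansion along the remaining columns.
    laplace-correct : ∀ n {M : Matrix ℚ (suc n)} {Mₚ} → M ≗ₚ Mₚ → ∀ k col acc sgn →
      laplace n M k col acc sgn ≡ acc + sgn * ⟦ laplaceₚ n Mₚ k col ⟧ ρ
    laplace-correct n {M} {Mₚ} M≗ zero col acc sgn = cong (λ t → acc + t)
      (trans (ℚ.*-assoc sgn _ _) (cong (sgn *_) (term-correct n {Mₚ = Mₚ} M≗ (col zero))))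
    laplace-correct n {M} {Mₚ} M≗ (suc k) col acc sgn =
      trans (laplace-correct n {Mₚ = Mₚ} M≗ k (λ t → col (suc t)) _ (- sgn)) (begin
        acc + sgn * x * d + (- sgn) * y  ≡⟨ S.solve 5 (λ a s x d y → a :+ s :* x :* d :+ (:- s) :* y S.:= a :+ s :* (x :* d :- y)) refl acc sgn x d y ⟩
        acc + sgn * (x * d + - y)        ≡⟨ cong (λ t → acc + sgn * (t + - y)) (term-correct n {Mₚ = Mₚ} M≗ (col zero)) ⟩
        acc + sgn * ⟦ laplaceₚ n Mₚ (suc k) col ⟧ ρ ∎)
      where
      open ≡-Reasoning
      x d y : ℚ
      x = M zero (col zero)
      d = det n (minor M (col zero))
      y = ⟦ laplaceₚ n Mₚ k (λ t → col (suc t)) ⟧ ρ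

-- Symbolic Sylvester matrices and resultants

coeffₚ : ∀ {n} → List (Polynomial n) → ℕ → Polynomial n
coeffₚ []      i       = con (+ 0)
coeffₚ (a ∷ f) zero    = a
coeffₚ (a ∷ f) (suc i) = coeffₚ f i

coeff-correct : ∀ {n} (f : List (Polynomial n)) ρ i → coeff (List.map (λ p → ⟦ p ⟧ ρ) f) i ≡ ⟦ coeffₚ f i ⟧ ρ
coeff-correct []      ρ i       = refl
coeff-correct (a ∷ f) ρ zero    = refl
coeff-correct (a ∷ f) ρ (suc i) = coeff-correct f ρ i

module _ {A : Set} (0# : A) (m : ℕ) where
  -- With `if` instead of `with` and an arbitrary entry type, one formula gives both the rational
  -- matrix and its symbolic lift.
  shiftedRow : (ℕ → A) → ℕ → ℕ → A
  shiftedRow h k s = if s ℕ.<ᵇ k then 0# else if (s ℕ.∸ k) ℕ.≤ᵇ m then h (m ℕ.∸ (s ℕ.∸ k)) else 0#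

  sylvesterMatrix : (ℕ → A) → (ℕ → A) → Matrix A (m ℕ.+ m)
  sylvesterMatrix f g r s = if toℕ r ℕ.<ᵇ m then shiftedRow f (toℕ r) (toℕ s) else shiftedRow g (toℕ r ℕ.∸ m) (toℕ s)

sylvester-unfold : ∀ m f g r s → sylvester m f g r s ≡ sylvesterMatrix 0ℚ m f g r s
sylvester-unfold m f g r s with toℕ r ℕ.<ᵇ m
sylvester-unfold m f g r s | true with toℕ s ℕ.<ᵇ toℕ r | (toℕ s ℕ.∸ toℕ r) ℕ.≤ᵇ m
... | true  | _     = refl
... | false | true  = refl
... | false | false = refl
sylvester-unfold m f g r s | false with toℕ s ℕ.<ᵇ (toℕ r ℕ.∸ m) | (toℕ s ℕ.∸ (toℕ r ℕ.∸ m)) ℕ.≤ᵇ m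
... | true  | _     = refl
... | false | true  = refl
... | false | false = refl

resultantFormsₚ : ∀ {n} m → (ℕ → Polynomial n) → (ℕ → Polynomial n) → Polynomial n
resultantFormsₚ m f g = detₚ (m ℕ.+ m) (sylvesterMatrix (con (+ 0)) m f g)

module _ {n} (ρ : Vec ℚ n) where
  if-correct : ∀ b {x y : ℚ} {p q : Polynomial n} → x ≡ ⟦ p ⟧ ρ → y ≡ ⟦ q ⟧ ρ → (if b then x else y) ≡ ⟦ (if b then p else q) ⟧ ρ
  if-correct true  x≡ y≡ = x≡
  if-correct false x≡ y≡ = y≡

  shiftedRow-correct : ∀ m {h} hₚ → (∀ i → h i ≡ ⟦ hₚ i ⟧ ρ) → ∀ k s →
    shiftedRow 0ℚ m h k s ≡ ⟦ shiftedRow (con (+ 0)) m hₚ k s ⟧ ρ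
  shiftedRow-correct m hₚ h≗ k s = if-correct (s ℕ.<ᵇ k) refl (if-correct ((s ℕ.∸ k) ℕ.≤ᵇ m) (h≗ _) refl)

  sylvester-correct : ∀ m {f g} fₚ gₚ → (∀ i → f i ≡ ⟦ fₚ i ⟧ ρ) → (∀ i → g i ≡ ⟦ gₚ i ⟧ ρ) →
    ∀ r s → sylvester m f g r s ≡ ⟦ sylvesterMatrix (con (+ 0)) m fₚ gₚ r s ⟧ ρ
  sylvester-correct m fₚ gₚ f≗ g≗ r s = trans (sylvester-unfold m _ _ r s)
    (if-correct (toℕ r ℕ.<ᵇ m) (shiftedRow-correct m fₚ f≗ (toℕ r) (toℕ s)) (shiftedRow-correct m gₚ g≗ (toℕ r ℕ.∸ m) (toℕ s)))

  resultantForms-correct : ∀ m {f g} fₚ gₚ → (∀ i → f i ≡ ⟦ fₚ i ⟧ ρ) → (∀ i → g i ≡ ⟦ gₚ i ⟧ ρ) →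
    resultantForms m f g ≡ ⟦ resultantFormsₚ m fₚ gₚ ⟧ ρ
  resultantForms-correct m fₚ gₚ f≗ g≗ = det-correct ρ (m ℕ.+ m) (sylvester-correct m fₚ gₚ f≗ g≗)

-- The discriminant of a sextic as a resultant

record Expansion (wrap : ℚ → ℚ) (y start : ℚ) : Set where
  constructor expansion
  field
    rest     : List ℚ
    expanded : y ≡ wrap (List.foldl _+_ start rest)

first : ℚ → ℚ → ℚ
first x d = 0ℚ + 1ℚ * x * d

-- In row 3 two minors `d₆` and `d₆′` are kept, which differ only in the deleted column. The absurd
-- equation `e` between these columns serves to let `cong!` find the function `D` from the deleted
-- column to the minor. Row 4 is the last shift of ∂F/∂X, row 5 the first of ∂F/∂Z.
record Unfolding (y c x x′ : ℚ) (X Z : ℕ → ℚ) : Set where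
  constructor unfolded
  field
    {d₉ d₈ d₇ d₆ d₆′} : ℚ
    {D E E′} : Fin 7 → ℚ
    row₀ : Expansion (λ t → - (c * t)) y (first x d₉)
    row₁ : Expansion (λ t → t) d₉ (first x d₈)
    row₂ : Expansion (λ t → t) d₈ (first x d₇)
    row₃ : Expansion (λ t → t) d₇ (first x d₆ + (- 1ℚ) * x′ * d₆′)
    minors : (e : _≡_ {A = Fin 7} 0F 1F) → Σ (d₆ ≡ d₆′) λ h → h ≅ cong D e
    row₄ : ∀ j → Expansion (λ t → t) (D j) (first (sylvester 5 X Z 4F (suc (suc (suc (punchIn j 0F))))) (E j))
    row₅ : ∀ j → Expansion (λ t → t) (E j) (first (sylvester 5 X Z 5F (suc (suc (suc (punchIn j 1F))))) (E′ j))

-- Two determinants of concrete size 10 are convertible in reasonable time only if their matrices agree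
-- syntactically, so the local functions FX and FZ of `discSextic` have to be recovered exactly; they are
-- the solutions of the two underscores.  Leading terms of the Laplace expansion are nonzero neutral
-- terms, hence the unifier can read off the minors behind them; `cong!` abstracts the deleted column of
-- a minor into a variable, and this makes `sylvester` get stuck with FX and FZ as its arguments.
discSextic-unfolding : ∀ F →
  Unfolding (discSextic F) (+ 1 / 1296) ((+ 6 / 1) * coeff F 6) ((+ 5 / 1) * coeff F 5) _ _
discSextic-unfolding F = unfolded
  (expansion (_ ∷ _ ∷ _ ∷ _ ∷ _ ∷ _ ∷ _ ∷ _ ∷ _ ∷ []) refl)
  (expansion (_ ∷ _ ∷ _ ∷ _ ∷ _ ∷ _ ∷ _ ∷ _ ∷ []) refl)
  (expansion (_ ∷ _ ∷ _ ∷ _ ∷ _ ∷ _ ∷ _ ∷ []) refl)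
  (expansion (_ ∷ _ ∷ _ ∷ _ ∷ _ ∷ []) refl)
  (λ e → cong! e , refl)
  (λ j → expansion (_ ∷ _ ∷ _ ∷ _ ∷ _ ∷ []) refl)
  (λ j → expansion (_ ∷ _ ∷ _ ∷ _ ∷ []) refl)

-- With the size `m` and the value `y` as variables, later lemmas can speak of the resultant without
-- unfolding a determinant of concrete size.
IsResultant : ℕ → ℚ → (ℕ → ℚ) → Set
IsResultant m y a = Σ (ℕ → ℚ) λ X → Σ (ℕ → ℚ) λ Z →
  (∀ j → X j ≡ toℚ (+ suc j) * a (suc j)) × (∀ j → Z j ≡ toℚ (+ (6 ℕ.∸ j)) * a j) ×
  y ≡ - ((+ 1 / 1296) * resultantForms m X Z)

discSextic-resultant : ∀ F → IsResultant 5 (discSextic F) (coeff F)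
-- `pack` takes the two coefficient functions from the type of the unfolding and returns them as
-- witnesses.
discSextic-resultant F = pack (discSextic-unfolding F) (λ j → refl) (λ j → refl) refl
  where
  pack : ∀ {y c x x′ X Z} → Unfolding y c x x′ X Z →
    (∀ j → X j ≡ toℚ (+ suc j) * coeff F (suc j)) → (∀ j → Z j ≡ toℚ (+ (6 ℕ.∸ j)) * coeff F j) →
    discSextic F ≡ - ((+ 1 / 1296) * resultantForms 5 X Z) → IsResultant 5 (discSextic F) (coeff F)
  pack {X = X} {Z} _ X≗ Z≗ eq = X , Z , X≗ , Z≗ , eq

-- The coefficient is the left factor because `⊡` prunes on that side: a zero coefficient stays the
-- literal zero that the expansion recognises.
∂X ∂Z : ∀ {n} → List (Polynomial n) → ℕ → Polynomial n
∂X F j = coeffₚ F (suc j) ⊡ con (+ suc j)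
∂Z F j = coeffₚ F j ⊡ con (+ (6 ℕ.∸ j))

evalCoeffs : ∀ {n} → Vec ℚ n → List (Polynomial n) → Poly
evalCoeffs ρ = List.map (λ p → ⟦ p ⟧ ρ)

scaled-coeff : ∀ {n} (F : List (Polynomial n)) ρ k j {x} → x ≡ toℚ (+ k) * coeff (evalCoeffs ρ F) j → x ≡ ⟦ coeffₚ F j ⊡ con (+ k) ⟧ ρ
scaled-coeff F ρ k j x≡ = trans x≡ (trans (cong (toℚ (+ k) *_) (coeff-correct F ρ j))
  (trans (ℚ.*-comm (toℚ (+ k)) _) (sym (⊡-correct (coeffₚ F j) (con (+ k)) ρ))))

resultant-correct : ∀ {n} m (F : List (Polynomial n)) ρ {y} → IsResultant m y (coeff (evalCoeffs ρ F)) →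
  y ≡ - ((+ 1 / 1296) * ⟦ resultantFormsₚ m (∂X F) (∂Z F) ⟧ ρ)
resultant-correct m F ρ (X , Z , X≗ , Z≗ , eq) = trans eq (cong (λ t → - ((+ 1 / 1296) * t))
  (resultantForms-correct ρ m (∂X F) (∂Z F) (λ j → scaled-coeff F ρ (suc j) (suc j) (X≗ j)) (λ j → scaled-coeff F ρ (6 ℕ.∸ j) j (Z≗ j))))

discSextic-correct : ∀ {n} (F : List (Polynomial n)) ρ →
  discSextic (evalCoeffs ρ F) ≡ - ((+ 1 / 1296) * ⟦ resultantFormsₚ 5 (∂X F) (∂Z F) ⟧ ρ)
discSextic-correct F ρ = resultant-correct 5 F ρ (discSextic-resultant (evalCoeffs ρ F))

-- The discriminant of a quintic with three known roots

κ : ∀ {n} → ℕ → Polynomial n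
κ k = con (+ k)

-- (x³ - σx² + τx - π)(4x² + ux + v)
quintic : ∀ {n} → (σ τ π u v : Polynomial n) → List (Polynomial n)
quintic σ τ π u v =
  (:- (v :* π)) ∷ (v :* τ :- u :* π) ∷ (u :* τ :- v :* σ :- κ 4 :* π) ∷ (v :- u :* σ :+ κ 4 :* τ) ∷ (u :- κ 4 :* σ) ∷ κ 4 ∷ []

cubicDisc : ∀ {n} → (σ τ π : Polynomial n) → Polynomial n
cubicDisc σ τ π = σ :* σ :* τ :* τ :- κ 4 :* τ :* τ :* τ :- κ 4 :* σ :* σ :* σ :* π :+ κ 18 :* σ :* τ :* π :- κ 27 :* π :* π

quadraticAt : ∀ {n} → (u v x : Polynomial n) → Polynomial n
quadraticAt u v x = κ 4 :* x :* x :+ u :* x :+ v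

-- The product of the values of 4x² + ux + v at the roots of x³ - σx² + τx - π.
crossResultant : ∀ {n} → (σ τ π u v : Polynomial n) → Polynomial n
crossResultant σ τ π u v =
  κ 64 :* π :* π :+ κ 16 :* u :* π :* τ :+ κ 16 :* v :* (τ :* τ :- κ 2 :* σ :* π) :+ κ 4 :* u :* u :* π :* σ
  :+ κ 4 :* u :* v :* (σ :* τ :- κ 3 :* π) :+ κ 4 :* v :* v :* (σ :* σ :- κ 2 :* τ)
  :+ u :* u :* u :* π :+ u :* u :* v :* τ :+ u :* v :* v :* σ :+ v :* v :* v

-- disc(gh) = disc(g) Res(g, h)² disc(h), where u² - 16v is the discriminant of 4x² + ux + v.
quinticDisc : ∀ {n} → (σ τ π u v : Polynomial n) → Polynomial n
quinticDisc σ τ π u v = cubicDisc σ τ π :* (crossResultant σ τ π u v :* crossResultant σ τ π u v) :* (u :* u :- κ 16 :* v)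

genericQuintic : List (Polynomial 5)
genericQuintic = quintic (var 0F) (var 1F) (var 2F) (var 3F) (var 4F)

genericDisc : Polynomial 5
genericDisc = quinticDisc (var 0F) (var 1F) (var 2F) (var 3F) (var 4F)

-- 1296 = 6⁴ and the sign undo the normalisation in `discSextic`. The factor 16 is the squared
-- leading coefficient, by which the discriminant of a sextic form with vanishing top coefficient
-- exceeds that of the quintic.
quintic-resultant : ∀ ρ → ⟦ resultantFormsₚ 5 (∂X genericQuintic) (∂Z genericQuintic) ⟧ ρ ≡ ⟦ :- (κ 1296 :* (κ 16 :* genericDisc)) ⟧ ρ
quintic-resultant = polynomial-identity (resultantFormsₚ 5 (∂X genericQuintic) (∂Z genericQuintic)) (:- (κ 1296 :* (κ 16 :* genericDisc))) refl

-- A second reading of the solver's syntax: identities are checked over ℚ and pulled back to ℤ along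
-- the injection `toℚ`.
evalℤ : ∀ {n} → Polynomial n → Vec ℤ n → ℤ
evalℤ (op S.[+] p q) ρ = evalℤ p ρ ℤ.+ evalℤ q ρ
evalℤ (op S.[*] p q) ρ = evalℤ p ρ ℤ.* evalℤ q ρ
evalℤ (con c)        ρ = c
evalℤ (var i)        ρ = Vec.lookup ρ i
evalℤ (p :^ zero)    ρ = + 1
evalℤ (p :^ suc k)   ρ = evalℤ p ρ ℤ.* evalℤ (p :^ k) ρ
evalℤ (:- p)         ρ = ℤ.- evalℤ p ρ

toℚ-evalℤ : ∀ {n} (p : Polynomial n) ρ → toℚ (evalℤ p ρ) ≡ ⟦ p ⟧ (Vec.map toℚ ρ)
toℚ-evalℤ (op S.[+] p q) ρ = trans (toℚ-+ (evalℤ p ρ) (evalℤ q ρ)) (cong₂ _+_ (toℚ-evalℤ p ρ) (toℚ-evalℤ q ρ))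
toℚ-evalℤ (op S.[*] p q) ρ = trans (toℚ-* (evalℤ p ρ) (evalℤ q ρ)) (cong₂ _*_ (toℚ-evalℤ p ρ) (toℚ-evalℤ q ρ))
toℚ-evalℤ (con c)        ρ = refl
toℚ-evalℤ (var i)        ρ = sym (lookup-map i toℚ ρ)
toℚ-evalℤ (p :^ zero)    ρ = refl
toℚ-evalℤ (p :^ suc k)   ρ = trans (toℚ-* (evalℤ p ρ) (evalℤ (p :^ k) ρ)) (cong₂ _*_ (toℚ-evalℤ p ρ) (toℚ-evalℤ (p :^ k) ρ))
toℚ-evalℤ (:- p)         ρ = trans (toℚ-neg (evalℤ p ρ)) (cong -_ (toℚ-evalℤ p ρ))

ℚ-cancel : ∀ {x y} → x ≢ 0ℚ → x * y ≡ 0ℚ → y ≡ 0ℚ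
ℚ-cancel {x} {y} x≢0 xy≡0 = begin
  y                  ≡⟨ sym (ℚ.*-identityˡ y) ⟩
  1ℚ * y             ≡⟨ cong (_* y) (sym (ℚ.*-inverseˡ x)) ⟩
  (1/ x) * x * y     ≡⟨ ℚ.*-assoc (1/ x) x y ⟩
  (1/ x) * (x * y)   ≡⟨ cong ((1/ x) *_) xy≡0 ⟩
  (1/ x) * 0ℚ        ≡⟨ ℚ.*-zeroʳ (1/ x) ⟩
  0ℚ                 ∎
  where
  open ≡-Reasoning
  instance
    x-nonZero : ℚ.NonZero x
    x-nonZero = ≢-nonZero x≢0

ℚ-minus≢0 : ∀ {x y} → x ≢ y → x + - y ≢ 0ℚ
ℚ-minus≢0 {x} {y} x≢y x-y≡0 = x≢y (begin
  x              ≡⟨ S.solve 2 (λ x y → x S.:= (x :- y) :+ y) refl x y ⟩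
  (x + - y) + y  ≡⟨ cong (_+ y) x-y≡0 ⟩
  0ℚ + y         ≡⟨ ℚ.+-identityˡ y ⟩
  y              ∎)
  where open ≡-Reasoning

-- Coefficients of 4P + Q² for P = x⁵ + p₄x⁴ + … and Q = q₂x² + q₁x + q₀, below the leading one.
record Coeffs (A : Set) : Set where
  constructor coeffs
  field e₀ e₁ e₂ e₃ e₄ : A

horner : ∀ {n} → Coeffs (Polynomial n) → Polynomial n → Polynomial n
horner (coeffs e₀ e₁ e₂ e₃ e₄) x = e₀ :+ x :* (e₁ :+ x :* (e₂ :+ x :* (e₃ :+ x :* (e₄ :+ x :* κ 4))))

value : Coeffs ℚ → ℚ → ℚ
value (coeffs e₀ e₁ e₂ e₃ e₄) x = e₀ + x * (e₁ + x * (e₂ + x * (e₃ + x * (e₄ + x * toℚ (+ 4)))))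

quinticCoeffs : Coeffs ℚ → List ℚ
quinticCoeffs (coeffs e₀ e₁ e₂ e₃ e₄) = e₀ ∷ e₁ ∷ e₂ ∷ e₃ ∷ e₄ ∷ toℚ (+ 4) ∷ []

sum₃ pairs₃ prod₃ : ∀ {n} → (a b c : Polynomial n) → Polynomial n
sum₃ a b c   = a :+ b :+ c
pairs₃ a b c = a :* b :+ b :* c :+ a :* c
prod₃ a b c  = a :* b :* c

-- The quotient of f by (x - a)(x - b)(x - c) is 4x² + ux + v; the coefficients of x⁴ and x³
-- determine u and v.
cofactorU cofactorV : ∀ {n} → Coeffs (Polynomial n) → (a b c : Polynomial n) → Polynomial n
cofactorU (coeffs _ _ _ _ e₄) a b c = e₄ :+ κ 4 :* sum₃ a b c
cofactorV e@(coeffs _ _ _ e₃ _) a b c = e₃ :+ cofactorU e a b c :* sum₃ a b c :- κ 4 :* pairs₃ a b c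

-- The divided difference f[a, b]; likewise `dd₂` is f[a, b, c]. Each power of x is replaced by a
-- complete homogeneous symmetric polynomial.
dd₁ : ∀ {n} → Coeffs (Polynomial n) → (a b : Polynomial n) → Polynomial n
dd₁ (coeffs e₀ e₁ e₂ e₃ e₄) a b =
  κ 4 :* (a :^ 4 :+ a :^ 3 :* b :+ a :^ 2 :* b :^ 2 :+ a :* b :^ 3 :+ b :^ 4)
  :+ e₄ :* (a :^ 3 :+ a :^ 2 :* b :+ a :* b :^ 2 :+ b :^ 3) :+ e₃ :* (a :^ 2 :+ a :* b :+ b :^ 2) :+ e₂ :* (a :+ b) :+ e₁

dd₂ : ∀ {n} → Coeffs (Polynomial n) → (a b c : Polynomial n) → Polynomial n
dd₂ (coeffs e₀ e₁ e₂ e₃ e₄) a b c =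
  κ 4 :* (a :^ 3 :+ b :^ 3 :+ c :^ 3 :+ a :^ 2 :* b :+ a :* b :^ 2 :+ a :^ 2 :* c :+ a :* c :^ 2 :+ b :^ 2 :* c :+ b :* c :^ 2 :+ a :* b :* c)
  :+ e₄ :* (a :^ 2 :+ b :^ 2 :+ c :^ 2 :+ a :* b :+ a :* c :+ b :* c) :+ e₃ :* (a :+ b :+ c) :+ e₂

coeffVars₈ : Coeffs (Polynomial 8)
coeffVars₈ = coeffs (var 0F) (var 1F) (var 2F) (var 3F) (var 4F)

module ThreeRoots (e : Coeffs ℚ) (a b c : ℚ) (a≢b : a ≢ b) (a≢c : a ≢ c) (b≢c : b ≢ c)
  (fa : value e a ≡ 0ℚ) (fb : value e b ≡ 0ℚ) (fc : value e c ≡ 0ℚ) where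
  open Coeffs e
  open ≡-Reasoning

  ρ : Vec ℚ 8
  ρ = e₀ ∷ e₁ ∷ e₂ ∷ e₃ ∷ e₄ ∷ a ∷ b ∷ c ∷ []

  A B C : Polynomial 8
  A = var 5F
  B = var 6F
  C = var 7F

  vanish : (p : Polynomial 8) → Set
  vanish p = ⟦ p ⟧ ρ ≡ 0ℚ

  private
    difference : ∀ {x y} → x ≡ 0ℚ → y ≡ 0ℚ → x + - y ≡ 0ℚ
    difference refl refl = refl

  -- Since f vanishes at the nodes and the nodes are distinct, the denominators of the divided
  -- differences cancel and all of these vanish too.
  dd₁-ab : vanish (dd₁ coeffVars₈ A B)
  dd₁-ab = ℚ-cancel (ℚ-minus≢0 a≢b) (trans
    (polynomial-identity ((A :- B) :* dd₁ coeffVars₈ A B) (horner coeffVars₈ A :- horner coeffVars₈ B) refl ρ) (difference fa fb))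

  dd₁-ac : vanish (dd₁ coeffVars₈ A C)
  dd₁-ac = ℚ-cancel (ℚ-minus≢0 a≢c) (trans
    (polynomial-identity ((A :- C) :* dd₁ coeffVars₈ A C) (horner coeffVars₈ A :- horner coeffVars₈ C) refl ρ) (difference fa fc))

  dd₂-abc : vanish (dd₂ coeffVars₈ A B C)
  dd₂-abc = ℚ-cancel (ℚ-minus≢0 b≢c) (trans
    (polynomial-identity ((B :- C) :* dd₂ coeffVars₈ A B C) (dd₁ coeffVars₈ A B :- dd₁ coeffVars₈ A C) refl ρ) (difference dd₁-ab dd₁-ac))

  U V : Polynomial 8
  U = cofactorU coeffVars₈ A B C
  V = cofactorV coeffVars₈ A B C

  symmetric : Vec ℚ 5
  symmetric = ⟦ sum₃ A B C ⟧ ρ ∷ ⟦ pairs₃ A B C ⟧ ρ ∷ ⟦ prod₃ A B C ⟧ ρ ∷ ⟦ U ⟧ ρ ∷ ⟦ V ⟧ ρ ∷ []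

  -- The coefficients are read off Newton's interpolation formula at the nodes a, b, c.
  private
    newton : ∀ {x y r s t} → x ≡ y + r + s + t → r ≡ 0ℚ → s ≡ 0ℚ → t ≡ 0ℚ → x ≡ y
    newton {y = y} eq refl refl refl = trans eq (trans (ℚ.+-identityʳ _) (trans (ℚ.+-identityʳ _) (ℚ.+-identityʳ y)))

    times0 : ∀ x {y} → y ≡ 0ℚ → x * y ≡ 0ℚ
    times0 x refl = ℚ.*-zeroʳ x

  factorisation : quinticCoeffs e ≡ evalCoeffs symmetric genericQuintic
  factorisation =
    cong₂ _∷_ (newton (polynomial-identity E0 (V' :+ horner coeffVars₈ A :+ :- A :* dd₁ coeffVars₈ A B :+ A :* B :* dd₂ coeffVars₈ A B C) refl ρ)
                 fa (times0 (- a) dd₁-ab) (times0 (a * b) dd₂-abc)) (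
    cong₂ _∷_ (newton (polynomial-identity (var 1F) ((V :* τ :- U :* π) :+ dd₁ coeffVars₈ A B :+ :- (A :+ B) :* dd₂ coeffVars₈ A B C :+ κ 0 :* κ 0) refl ρ)
                 dd₁-ab (times0 (- (a + b)) dd₂-abc) refl) (
    cong₂ _∷_ (newton (polynomial-identity (var 2F) ((U :* τ :- V :* σ :- κ 4 :* π) :+ dd₂ coeffVars₈ A B C :+ κ 0 :+ κ 0) refl ρ) dd₂-abc refl refl) (
    cong₂ _∷_ (polynomial-identity (var 3F) (V :- U :* σ :+ κ 4 :* τ) refl ρ) (
    cong₂ _∷_ (polynomial-identity (var 4F) (U :- κ 4 :* σ) refl ρ) refl))))
    where
    σ τ π E0 V' : Polynomial 8
    σ = sum₃ A B C
    τ = pairs₃ A B C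
    π = prod₃ A B C
    E0 = var 0F
    V' = :- (V :* π)

differences : ∀ {n} → (a b c : Polynomial n) → Polynomial n
differences a b c = (a :- b) :* (a :- c) :* (b :- c)

quadraticAtRoots : ∀ {n} → (u v a b c : Polynomial n) → Polynomial n
quadraticAtRoots u v a b c = quadraticAt u v a :* quadraticAt u v b :* quadraticAt u v c

rootDisc : ∀ {n} → (a b c u v : Polynomial n) → Polynomial n
rootDisc a b c u v = (differences a b c :* differences a b c)
  :* (quadraticAtRoots u v a b c :* quadraticAtRoots u v a b c) :* (u :* u :- κ 16 :* v)

genericRootDisc : Polynomial 5
genericRootDisc = rootDisc (var 0F) (var 1F) (var 2F) (var 3F) (var 4F)

module _ (a b c u v : ℚ) where
  private
    A B C U V : Polynomial 5
    A = var 0F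
    B = var 1F
    C = var 2F
    U = var 3F
    V = var 4F
    ρ : Vec ℚ 5
    ρ = a ∷ b ∷ c ∷ u ∷ v ∷ []

  -- The cubic discriminant is the squared product of differences, the resultant the product of the
  -- values at the roots. Comparing the two factors separately avoids expanding the whole
  -- discriminant in the roots.
  genericDisc-roots : ⟦ genericDisc ⟧ (⟦ sum₃ A B C ⟧ ρ ∷ ⟦ pairs₃ A B C ⟧ ρ ∷ ⟦ prod₃ A B C ⟧ ρ ∷ u ∷ v ∷ []) ≡ ⟦ genericRootDisc ⟧ ρ
  genericDisc-roots = cong₂ (λ x y → x * (y * y) * (u * u + - (toℚ (+ 16) * v)))
    (polynomial-identity (cubicDisc (sum₃ A B C) (pairs₃ A B C) (prod₃ A B C)) (differences A B C :* differences A B C) refl ρ)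
    (polynomial-identity (crossResultant (sum₃ A B C) (pairs₃ A B C) (prod₃ A B C) U V) (quadraticAtRoots U V A B C) refl ρ)

normalising-constant : ∀ {r D} → r ≡ - (toℚ (+ 1296) * (toℚ (+ 16) * D)) → - ((+ 1 / 1296) * r) ≡ toℚ (+ 16) * D
normalising-constant {D = D} refl = begin
  - (w * - (toℚ (+ 1296) * (toℚ (+ 16) * D)))  ≡⟨ S.solve 2 (λ w D → :- (w :* :- (κ 1296 :* (κ 16 :* D))) S.:= (w :* κ 1296) :* (κ 16 :* D)) refl w D ⟩
  (w * toℚ (+ 1296)) * (toℚ (+ 16) * D)        ≡⟨⟩
  1ℚ * (toℚ (+ 16) * D)                        ≡⟨ ℚ.*-identityˡ (toℚ (+ 16) * D) ⟩
  toℚ (+ 16) * D                               ∎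
  where
  open ≡-Reasoning
  w : ℚ
  w = + 1 / 1296

discSextic-symmetric : ∀ ρ → discSextic (evalCoeffs ρ genericQuintic) ≡ toℚ (+ 16) * ⟦ genericDisc ⟧ ρ
discSextic-symmetric ρ = trans (discSextic-correct genericQuintic ρ) (normalising-constant {⟦ resultantFormsₚ 5 (∂X genericQuintic) (∂Z genericQuintic) ⟧ ρ} {⟦ genericDisc ⟧ ρ} (quintic-resultant ρ))

-- The constants match because 4096 = 256 · 16.
Δ-constant : ∀ {d D} → d ≡ toℚ (+ 16) * D → toℚ (+ 256) * ((+ 1 / 4096) * d) ≡ D
Δ-constant {D = D} refl = begin
  toℚ (+ 256) * (w * (toℚ (+ 16) * D))  ≡⟨ S.solve 2 (λ w D → κ 256 :* (w :* (κ 16 :* D)) S.:= (w :* κ 4096) :* D) refl w D ⟩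
  (w * toℚ (+ 4096)) * D                ≡⟨⟩
  1ℚ * D                                ≡⟨ ℚ.*-identityˡ D ⟩
  D                                     ∎
  where
  open ≡-Reasoning
  w : ℚ
  w = + 1 / 4096

Δ-disc : ∀ {E P Q F} D → E ≡ weq P Q → scale (+ 4 / 1) P ⊕ (Q ⊗ Q) ≡ F → discSextic F ≡ toℚ (+ 16) * D → toℚ (+ 256) * Δ E ≡ D
Δ-disc {P = P} {Q} D refl refl eq = Δ-constant {discSextic (scale (+ 4 / 1) P ⊕ (Q ⊗ Q))} {D} eq

-- The discriminant of 4P + Q²

completeSquare : ∀ {n} → (p₀ p₁ p₂ p₃ p₄ q₀ q₁ q₂ : Polynomial n) → Coeffs (Polynomial n)
completeSquare p₀ p₁ p₂ p₃ p₄ q₀ q₁ q₂ = coeffs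
  (q₀ :* q₀ :+ κ 4 :* p₀) (κ 2 :* q₀ :* q₁ :+ κ 4 :* p₁) (q₁ :* q₁ :+ κ 2 :* q₀ :* q₂ :+ κ 4 :* p₂)
  (κ 2 :* q₁ :* q₂ :+ κ 4 :* p₃) (q₂ :* q₂ :+ κ 4 :* p₄)

mapCoeffs : ∀ {A B : Set} → (A → B) → Coeffs A → Coeffs B
mapCoeffs f (coeffs e₀ e₁ e₂ e₃ e₄) = coeffs (f e₀) (f e₁) (f e₂) (f e₃) (f e₄)

genericSquare : Coeffs (Polynomial 8)
genericSquare = completeSquare (var 0F) (var 1F) (var 2F) (var 3F) (var 4F) (var 5F) (var 6F) (var 7F)

module Equation (p : Vec ℤ 5) (q : Vec ℤ 3) where
  ρ : Vec ℚ 8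
  ρ = Vec.map toℚ (p Vec.++ q)

  e : Coeffs ℚ
  e = mapCoeffs (λ x → ⟦ x ⟧ ρ) genericSquare

sextic-coeffs : ∀ p q → scale (+ 4 / 1) (Pmonic5 p) ⊕ (Qdeg2 q ⊗ Qdeg2 q) ≡ quinticCoeffs (Equation.e p q)
sextic-coeffs p@(_ ∷ _ ∷ _ ∷ _ ∷ _ ∷ []) q@(_ ∷ _ ∷ _ ∷ []) =
  -- The left polynomials imitate the terms to which `⊗` and `⊕` reduce, including their trailing
  -- zeros.
  cong₂ _∷_ (polynomial-identity (κ 4 :* var 0F :+ (q₀ :* q₀ :+ κ 0)) e₀ refl ρ) (
  cong₂ _∷_ (polynomial-identity (κ 4 :* var 1F :+ (q₀ :* q₁ :+ (q₁ :* q₀ :+ κ 0))) e₁ refl ρ) (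
  cong₂ _∷_ (polynomial-identity (κ 4 :* var 2F :+ (q₀ :* q₂ :+ (q₁ :* q₁ :+ (q₂ :* q₀ :+ κ 0)))) e₂ refl ρ) (
  cong₂ _∷_ (polynomial-identity (κ 4 :* var 3F :+ (q₁ :* q₂ :+ q₂ :* q₁)) e₃ refl ρ) (
  cong₂ _∷_ (polynomial-identity (κ 4 :* var 4F :+ q₂ :* q₂) e₄ refl ρ) refl))))
  where
  open Equation p q using (ρ)
  open Coeffs genericSquare
  q₀ q₁ q₂ : Polynomial 8
  q₀ = var 5F
  q₁ = var 6F
  q₂ = var 7F

module _ (p : Vec ℤ 5) (q : Vec ℤ 3) {a b c : ℚ} (a≢b : a ≢ b) (a≢c : a ≢ c) (b≢c : b ≢ c)
  (fa : value (Equation.e p q) a ≡ 0ℚ) (fb : value (Equation.e p q) b ≡ 0ℚ) (fc : value (Equation.e p q) c ≡ 0ℚ) where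
  private module T = ThreeRoots (Equation.e p q) a b c a≢b a≢c b≢c fa fb fc

  Δ-roots : toℚ (+ 256) * Δ (eqn p q) ≡ ⟦ genericRootDisc ⟧ (a ∷ b ∷ c ∷ ⟦ T.U ⟧ T.ρ ∷ ⟦ T.V ⟧ T.ρ ∷ [])
  Δ-roots = trans
    (Δ-disc {eqn p q} {Pmonic5 p} {Qdeg2 q} {evalCoeffs T.symmetric genericQuintic} (⟦ genericDisc ⟧ T.symmetric) refl
      (trans (sextic-coeffs p q) T.factorisation) (discSextic-symmetric T.symmetric))
    (genericDisc-roots a b c (⟦ T.U ⟧ T.ρ) (⟦ T.V ⟧ T.ρ))

-- Arithmetic of the roots

identityℤ : ∀ {n} (p q : Polynomial n) → is-just (normalise p ≟N normalise q) ≡ true → ∀ ρ → evalℤ p ρ ≡ evalℤ q ρ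
identityℤ p q eq ρ = toℚ-injective (trans (toℚ-evalℤ p ρ)
  (trans (polynomial-identity p q eq (Vec.map toℚ ρ)) (sym (toℚ-evalℤ q ρ))))

ℤ-cancel : ∀ {x y} → x ≢ + 0 → x ℤ.* y ≡ + 0 → y ≡ + 0
ℤ-cancel {x} x≢0 xy≡0 with ℤ.i*j≡0⇒i≡0∨j≡0 x xy≡0
... | inj₁ x≡0 = ⊥-elim (x≢0 x≡0)
... | inj₂ y≡0 = y≡0

minus≢0 : ∀ {x y} → x ≢ y → x ℤ.- y ≢ + 0
minus≢0 {x} {y} x≢y eq = x≢y (ℤ.i-j≡0⇒i≡j x y eq)

Even Odd : ℤ → Set
Even n = ∃ λ k → n ≡ + 2 ℤ.* k
Odd n  = ∃ λ k → n ≡ + 1 ℤ.+ + 2 ℤ.* k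

parity : ∀ n → Even n ⊎ Odd n
parity n with n %ℕ 2 | n%ℕd<d n 2 | a≡a%ℕn+[a/ℕn]*n n 2
... | 0 | _ | eq = inj₁ (n /ℕ 2 , trans eq (trans (ℤ.+-identityˡ _) (ℤ.*-comm (n /ℕ 2) (+ 2))))
... | 1 | _ | eq = inj₂ (n /ℕ 2 , trans eq (cong (ℤ._+_ (+ 1)) (ℤ.*-comm (n /ℕ 2) (+ 2))))
... | suc (suc _) | s≤s (s≤s ()) | _

2k≢1 : ∀ k → + 2 ℤ.* k ≢ + 1
2k≢1 k eq with ∣1⇒≡1 (divides ℤ.∣ k ∣ (sym (trans (ℕ.*-comm ℤ.∣ k ∣ 2) (trans (sym (ℤ.abs-* (+ 2) k)) (cong ℤ.∣_∣ eq)))))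
... | ()

odd-even-⊥ : ∀ {n} → Odd n → Even n → ⊥
odd-even-⊥ (k , refl) (m , eq) = 2k≢1 (m ℤ.- k) (trans
  (identityℤ (κ 2 :* (var 0F :- var 1F)) (κ 2 :* var 0F :- κ 2 :* var 1F) refl (m ∷ k ∷ []))
  (trans (cong (λ t → t ℤ.+ ℤ.- (+ 2 ℤ.* k)) (sym eq))
    (identityℤ ((κ 1 :+ κ 2 :* var 0F) :- κ 2 :* var 0F) (κ 1) refl (k ∷ []))))

even-square : ∀ {n} → Even (n ℤ.* n) → Even n
even-square {n} n²-even with parity n
... | inj₁ n-even     = n-even
... | inj₂ (k , refl) = ⊥-elim (odd-even-⊥
  (+ 2 ℤ.* k ℤ.* k ℤ.+ + 2 ℤ.* k
    , identityℤ ((κ 1 :+ κ 2 :* x) :* (κ 1 :+ κ 2 :* x)) (κ 1 :+ κ 2 :* (κ 2 :* x :* x :+ κ 2 :* x)) refl (k ∷ []))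
  n²-even)
  where
  x : Polynomial 1
  x = var 0F

-- The monic polynomial 4⁴ f(x / 4), whose roots are the integers 4a for the rational roots a of f.
monic : ∀ {n} → Coeffs (Polynomial n) → Polynomial n → Polynomial n
monic (coeffs e₀ e₁ e₂ e₃ e₄) x = x :^ 5 :+ e₄ :* x :^ 4 :+ κ 4 :* e₃ :* x :^ 3 :+ κ 16 :* e₂ :* x :^ 2 :+ κ 64 :* e₁ :* x :+ κ 256 :* e₀

monic-dd : ∀ {n} → Coeffs (Polynomial n) → (a b : Polynomial n) → Polynomial n
monic-dd (coeffs e₀ e₁ e₂ e₃ e₄) a b =
  a :^ 4 :+ a :^ 3 :* b :+ a :^ 2 :* b :^ 2 :+ a :* b :^ 3 :+ b :^ 4
  :+ e₄ :* (a :^ 3 :+ a :^ 2 :* b :+ a :* b :^ 2 :+ b :^ 3)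
  :+ κ 4 :* e₃ :* (a :^ 2 :+ a :* b :+ b :^ 2) :+ κ 16 :* e₂ :* (a :+ b) :+ κ 64 :* e₁

coeffVars : ∀ {n} → Coeffs (Polynomial (5 ℕ.+ n))
coeffVars = coeffs (var 0F) (var 1F) (var 2F) (var 3F) (var 4F)

monicRoot : Coeffs ℤ → ℤ → Set
monicRoot (coeffs e₀ e₁ e₂ e₃ e₄) x = evalℤ (monic coeffVars (var 5F)) (e₀ ∷ e₁ ∷ e₂ ∷ e₃ ∷ e₄ ∷ x ∷ []) ≡ + 0

private
  difference : ∀ {x y} → x ≡ + 0 → y ≡ + 0 → x ℤ.+ ℤ.- y ≡ + 0
  difference refl refl = refl

-- The divided difference at two distinct roots is zero. At odd arguments it is odd: five odd
-- monomials of degree 4, then e₄ times a sum of four odd ones, then multiples of 4.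
odd-roots-⊥ : ∀ e {x y} → monicRoot e x → monicRoot e y → x ≢ y → Odd x → Odd y → ⊥
odd-roots-⊥ (coeffs e₀ e₁ e₂ e₃ e₄) gx gy x≢y (k , refl) (l , refl) =
  odd-even-⊥ (evalℤ half ρ , trans (identityℤ (monic-dd coeffVars X Y) (κ 1 :+ κ 2 :* half) refl ρ) refl)
    (+ 0 , ℤ-cancel (minus≢0 x≢y) (trans (identityℤ ((X :- Y) :* monic-dd coeffVars X Y) (monic coeffVars X :- monic coeffVars Y) refl ρ) (difference gx gy)))
  where
  ρ : Vec ℤ 7
  ρ = e₀ ∷ e₁ ∷ e₂ ∷ e₃ ∷ e₄ ∷ k ∷ l ∷ []
  s t X Y s₂ t₂ m half : Polynomial 7
  s = var 5F
  t = var 6F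
  X = κ 1 :+ κ 2 :* s
  Y = κ 1 :+ κ 2 :* t
  -- X² = 1 + 2 s₂, Y² = 1 + 2 t₂ and XY = 1 + 2 m, so the excess of each quartic monomial over 1 is
  -- an explicit double.
  s₂ = κ 2 :* s :* s :+ κ 2 :* s
  t₂ = κ 2 :* t :* t :+ κ 2 :* t
  m = s :+ t :+ κ 2 :* s :* t
  half = κ 2 :+ (κ 2 :* s₂ :* s₂ :+ κ 2 :* s₂) :+ (s₂ :+ m :+ κ 2 :* s₂ :* m) :+ (κ 2 :* m :* m :+ κ 2 :* m)
    :+ (t₂ :+ m :+ κ 2 :* t₂ :* m) :+ (κ 2 :* t₂ :* t₂ :+ κ 2 :* t₂)
    :+ var 4F :* (κ 1 :+ s :+ t) :* (X :^ 2 :+ Y :^ 2)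
    :+ κ 2 :* var 3F :* (X :^ 2 :+ X :* Y :+ Y :^ 2) :+ κ 8 :* var 2F :* (X :+ Y) :+ κ 32 :* var 1F

coefficients : Vec ℤ 8 → Coeffs ℤ
coefficients ρ = mapCoeffs (λ x → evalℤ x ρ) genericSquare

-- Suppose x = 2X with X odd. Divided by 16, the equation reads 2X⁵ + e₄X⁴ + 2e₃X³ + 4e₂X² + ... =
-- 0, so e₄ = q₂² + 4p₄ is even and hence q₂ is. Then 4 divides e₄ and e₃ = 2q₁q₂ + 4p₃, and 2X⁵
-- would be divisible by 4.
even-root : ∀ ρ {x} → monicRoot (coefficients ρ) x → Even x → ∃ λ k → x ≡ + 4 ℤ.* k
even-root ρ₀@(p₀ ∷ p₁ ∷ p₂ ∷ p₃ ∷ p₄ ∷ q₀ ∷ q₁ ∷ q₂ ∷ []) gx (h , refl) with parity h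
... | inj₁ (k , refl) = k , identityℤ (κ 2 :* (κ 2 :* var 0F)) (κ 4 :* var 0F) refl (k ∷ [])
... | inj₂ (k , refl) = ⊥-elim (contra (even-square q₂²-even))
  where
  ρ : Vec ℤ 9
  ρ = p₀ ∷ p₁ ∷ p₂ ∷ p₃ ∷ p₄ ∷ q₀ ∷ q₁ ∷ q₂ ∷ k ∷ []
  P₄ Q₁ Q₂ s X s₂ s₄ tail : Polynomial 9
  E : Coeffs (Polynomial 9)
  E = completeSquare (var 0F) (var 1F) (var 2F) (var 3F) (var 4F) (var 5F) (var 6F) (var 7F)
  open Coeffs E
  P₄ = var 4F
  Q₁ = var 6F
  Q₂ = var 7F
  s = var 8F
  X = κ 1 :+ κ 2 :* s
  s₂ = κ 2 :* s :* s :+ κ 2 :* s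
  s₄ = κ 2 :* s₂ :* s₂ :+ κ 2 :* s₂
  tail = e₃ :* X :^ 3 :+ κ 2 :* e₂ :* X :^ 2 :+ κ 4 :* e₁ :* X :+ κ 8 :* e₀
  reduced : evalℤ (κ 2 :* X :^ 5 :+ e₄ :* X :^ 4 :+ κ 2 :* tail) ρ ≡ + 0
  reduced = ℤ-cancel {+ 16} (λ ()) (trans (identityℤ (κ 16 :* (κ 2 :* X :^ 5 :+ e₄ :* X :^ 4 :+ κ 2 :* tail)) (monic E (κ 2 :* X)) refl ρ) gx)
  q₂²-even : Even (q₂ ℤ.* q₂)
  q₂²-even = evalℤ w ρ , trans (identityℤ (Q₂ :* Q₂) ((κ 2 :* X :^ 5 :+ e₄ :* X :^ 4 :+ κ 2 :* tail) :+ κ 2 :* w) refl ρ)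
    (trans (cong (λ t → t ℤ.+ (+ 2) ℤ.* evalℤ w ρ) reduced) (ℤ.+-identityˡ _))
    where
    w : Polynomial 9
    -- X⁴ = 1 + 2 s₄ isolates q₂² in e₄X⁴ up to an even number.
    w = :- (X :^ 5 :+ e₄ :* s₄ :+ tail) :- κ 2 :* P₄
  contra : Even q₂ → ⊥
  contra (r , refl) = odd-even-⊥
    (evalℤ five ρ′ , identityℤ (Y :^ 5) (κ 1 :+ κ 2 :* five) refl ρ′)
    (evalℤ w ρ′ , ℤ.i-j≡0⇒i≡j _ _ (ℤ-cancel {+ 2} (λ ()) (trans (identityℤ (κ 2 :* (Y :^ 5 :- κ 2 :* w)) (κ 2 :* Y :^ 5 :+ E′.e₄ :* Y :^ 4 :+ κ 2 :* tail′) refl ρ′) reduced)))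
    where
    ρ′ : Vec ℤ 9
    ρ′ = p₀ ∷ p₁ ∷ p₂ ∷ p₃ ∷ p₄ ∷ q₀ ∷ q₁ ∷ r ∷ k ∷ []
    E″ : Coeffs (Polynomial 9)
    E″ = completeSquare (var 0F) (var 1F) (var 2F) (var 3F) (var 4F) (var 5F) (var 6F) (κ 2 :* var 7F)
    module E′ = Coeffs E″
    Y tail′ w five : Polynomial 9
    Y = κ 1 :+ κ 2 :* s
    tail′ = E′.e₃ :* Y :^ 3 :+ κ 2 :* E′.e₂ :* Y :^ 2 :+ κ 4 :* E′.e₁ :* Y :+ κ 8 :* E′.e₀
    five = s :+ s₄ :+ κ 2 :* s :* s₄
    w = :- ((var 7F :* var 7F :+ P₄) :* Y :^ 4 :+ κ 2 :* (Q₁ :* var 7F :+ var 3F) :* Y :^ 3 :+ E′.e₂ :* Y :^ 2 :+ κ 2 :* E′.e₁ :* Y :+ κ 4 :* E′.e₀)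

-- Parity of the discriminant for roots b - s, b, b + s

mixed-squares-odd : ∀ k l → Odd (+ 2 ℤ.* k ℤ.* (+ 2 ℤ.* k) ℤ.+ (+ 1 ℤ.+ + 2 ℤ.* l) ℤ.* (+ 1 ℤ.+ + 2 ℤ.* l))
mixed-squares-odd k l = evalℤ half (k ∷ l ∷ []) , identityℤ
  (κ 2 :* var 0F :* (κ 2 :* var 0F) :+ (κ 1 :+ κ 2 :* var 1F) :* (κ 1 :+ κ 2 :* var 1F)) (κ 1 :+ κ 2 :* half) refl (k ∷ l ∷ [])
  where
  half : Polynomial 2
  half = κ 2 :* var 0F :* var 0F :+ κ 2 :* var 1F :* var 1F :+ κ 2 :* var 1F

quadruple : ∀ w → + 4 ℤ.* w ≡ + 2 ℤ.* (+ 2 ℤ.* w)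
quadruple w = identityℤ (κ 4 :* var 0F) (κ 2 :* (κ 2 :* var 0F)) refl (w ∷ [])

-- Squares are 0 or 1 modulo 4; two odd squares add up to 2 modulo 4.
both-even : ∀ {x y w} → x ℤ.* x ℤ.+ y ℤ.* y ≡ + 4 ℤ.* w → Even x × Even y
both-even {x} {y} {w} eq with parity x | parity y
... | inj₁ x-even     | inj₁ y-even     = x-even , y-even
... | inj₁ (k , refl) | inj₂ (l , refl) = ⊥-elim (odd-even-⊥ (mixed-squares-odd k l) (+ 2 ℤ.* w , trans eq (quadruple w)))
... | inj₂ (k , refl) | inj₁ (l , refl) = ⊥-elim (odd-even-⊥ (mixed-squares-odd l k) (+ 2 ℤ.* w , trans (ℤ.+-comm (+ 2 ℤ.* l ℤ.* (+ 2 ℤ.* l)) _) (trans eq (quadruple w))))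
... | inj₂ (k , refl) | inj₂ (l , refl) = ⊥-elim (odd-even-⊥
  (evalℤ half (k ∷ l ∷ w ∷ []) , refl)
  (w , ℤ.i-j≡0⇒i≡j _ _ (ℤ-cancel {+ 2} (λ ()) (trans
    (identityℤ (κ 2 :* ((κ 1 :+ κ 2 :* half) :- κ 2 :* var 2F))
      ((κ 1 :+ κ 2 :* var 0F) :* (κ 1 :+ κ 2 :* var 0F) :+ (κ 1 :+ κ 2 :* var 1F) :* (κ 1 :+ κ 2 :* var 1F) :- κ 4 :* var 2F) refl (k ∷ l ∷ w ∷ []))
    (ℤ.i≡j⇒i-j≡0 eq)))))
  where
  half : Polynomial 3
  half = var 0F :* var 0F :+ var 0F :+ var 1F :* var 1F :+ var 1F

-- Coefficients of P(b + x) and Q(b + x).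
module Shift {n} (p₀ p₁ p₂ p₃ p₄ q₀ q₁ q₂ b : Polynomial n) where
  P₀ P₂ P₃ P₄ Q₀ Q₁ : Polynomial n
  P₀ = p₀ :+ p₁ :* b :+ p₂ :* b :^ 2 :+ p₃ :* b :^ 3 :+ p₄ :* b :^ 4 :+ b :^ 5
  P₂ = p₂ :+ κ 3 :* p₃ :* b :+ κ 6 :* p₄ :* b :^ 2 :+ κ 10 :* b :^ 3
  P₃ = p₃ :+ κ 4 :* p₄ :* b :+ κ 10 :* b :^ 2
  P₄ = p₄ :+ κ 5 :* b
  Q₀ = q₀ :+ q₁ :* b :+ q₂ :* b :^ 2
  Q₁ = q₁ :+ κ 2 :* q₂ :* b

-- The discriminant of x(x² - s²)(4x² + Ux + V).
centredDisc : ∀ {n} → (s U V : Polynomial n) → Polynomial n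
centredDisc s U V = κ 4 :* s :^ 6 :* (V :* (κ 4 :* s :^ 2 :+ U :* s :+ V) :* (κ 4 :* s :^ 2 :- U :* s :+ V)) :^ 2 :* (U :^ 2 :- κ 16 :* V)

module _ {z} (s U V : ℤ) (eq : + 256 ℤ.* z ≡ evalℤ (centredDisc (var 0F) (var 1F) (var 2F)) (s ∷ U ∷ V ∷ [])) where
  -- The power 2⁸ on the left must be exceeded: 4s⁶ supplies 2⁸, and the three even factors under
  -- the square supply 2⁶.
  even-centred₀ : ∀ k w → s ≡ + 2 ℤ.* k → V ≡ + 2 ℤ.* w → Even z
  even-centred₀ k w refl refl = evalℤ half (k ∷ U ∷ w ∷ []) , ℤ.*-cancelˡ-≡ (+ 256) z _ (trans eq
    (identityℤ (centredDisc (κ 2 :* k') U' (κ 2 :* w')) (κ 256 :* (κ 2 :* half)) refl (k ∷ U ∷ w ∷ [])))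
    where
    k' U' w' half : Polynomial 3
    k' = var 0F
    U' = var 1F
    w' = var 2F
    half = κ 32 :* k' :^ 6 :* (w' :* (κ 8 :* k' :^ 2 :+ U' :* k' :+ w') :* (κ 8 :* k' :^ 2 :- U' :* k' :+ w')) :^ 2 :* (U' :^ 2 :- κ 32 :* w')

  -- Here s contributes nothing: the constant gives 2², the three squared multiples of 4 give 2¹²,
  -- and U² - 16V gives 2⁴.
  even-centred₁ : ∀ u v → U ≡ + 4 ℤ.* u → V ≡ + 4 ℤ.* v → Even z
  even-centred₁ u v refl refl = evalℤ half (s ∷ u ∷ v ∷ []) , ℤ.*-cancelˡ-≡ (+ 256) z _ (trans eq
    (identityℤ (centredDisc s' (κ 4 :* u') (κ 4 :* v')) (κ 256 :* (κ 2 :* half)) refl (s ∷ u ∷ v ∷ [])))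
    where
    s' u' v' half : Polynomial 3
    s' = var 0F
    u' = var 1F
    v' = var 2F
    half = κ 512 :* s' :^ 6 :* (v' :* (s' :^ 2 :+ u' :* s' :+ v') :* (s' :^ 2 :- u' :* s' :+ v')) :^ 2 :* (u' :^ 2 :- κ 4 :* v')

-- The case in which f = 4P + Q² has the integral roots b - s, b, b + s.
module Centred (p₀ p₁ p₂ p₃ p₄ q₀ q₁ q₂ b s : ℤ) where
  ρ : Vec ℤ 10
  ρ = p₀ ∷ p₁ ∷ p₂ ∷ p₃ ∷ p₄ ∷ q₀ ∷ q₁ ∷ q₂ ∷ b ∷ s ∷ []
  E : Coeffs (Polynomial 10)
  E = completeSquare (var 0F) (var 1F) (var 2F) (var 3F) (var 4F) (var 5F) (var 6F) (var 7F)
  B S′ Q₂ : Polynomial 10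
  B = var 8F
  S′ = var 9F
  Q₂ = var 7F
  open Shift {10} (var 0F) (var 1F) (var 2F) (var 3F) (var 4F) (var 5F) (var 6F) (var 7F) B
  -- In f(b + x) = x(x² - s²)(4x² + Ux + V) the coefficient of x⁴ is U and that of x³ is V - 4s².
  U V : Polynomial 10
  U = Q₂ :* Q₂ :+ κ 4 :* P₄
  V = κ 2 :* Q₁ :* Q₂ :+ κ 4 :* P₃ :+ κ 4 :* S′ :^ 2

  module _ {z : ℤ} (s≢0 : s ≢ + 0)
    (f₀ : evalℤ (horner E B) ρ ≡ + 0) (f₊ : evalℤ (horner E (B :+ S′)) ρ ≡ + 0) (f₋ : evalℤ (horner E (B :- S′)) ρ ≡ + 0)
    (disc : + 256 ℤ.* z ≡ evalℤ (centredDisc (var 0F) (var 1F) (var 2F)) (s ∷ evalℤ U ρ ∷ evalℤ V ρ ∷ [])) where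

    V-even : ∃ λ w → evalℤ V ρ ≡ + 2 ℤ.* w
    V-even = _ , identityℤ V (κ 2 :* (Q₁ :* Q₂ :+ κ 2 :* P₃ :+ κ 2 :* S′ :^ 2)) refl ρ

    -- 0 = f(b) = Q(b)² + 4P(b).
    q̃₀-even : Even (evalℤ Q₀ ρ)
    q̃₀-even = even-square (_ , ℤ.i-j≡0⇒i≡j _ _ (trans
      (identityℤ (Q₀ :* Q₀ :- κ 2 :* (:- (κ 2 :* P₀))) (horner E B) refl ρ) f₀))

    -- The coefficient of x² in f(b + x) is - s² times that of x⁴.
    middle : evalℤ (Q₁ :* Q₁ :+ κ 2 :* Q₀ :* Q₂ :+ κ 4 :* P₂ :+ S′ :* S′ :* U) ρ ≡ + 0
    middle = ℤ-cancel s≢0 (ℤ-cancel s≢0 (ℤ-cancel {+ 2} (λ ()) (trans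
      (identityℤ (κ 2 :* (S′ :* (S′ :* (Q₁ :* Q₁ :+ κ 2 :* Q₀ :* Q₂ :+ κ 4 :* P₂ :+ S′ :* S′ :* U))))
        ((horner E (B :+ S′) :+ horner E (B :- S′)) :- κ 2 :* horner E B) refl ρ)
      (zero-sum f₊ f₋ f₀))))
      where
      zero-sum : ∀ {x y w} → x ≡ + 0 → y ≡ + 0 → w ≡ + 0 → (x ℤ.+ y) ℤ.+ ℤ.- (+ 2 ℤ.* w) ≡ + 0
      zero-sum refl refl refl = refl

    -- Reduce `middle` modulo 4: since Q(b) is even and s² = 1 + 4(k + k²), what remains is Q̃₁² +
    -- q₂² ≡ 0, where Q̃₁ is the value of `Q₁`. So Q̃₁ and q₂ are even, and 4 divides both U and V.
    odd-case : Odd s → Even z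
    odd-case (k , s≡) = with-q̃₀ q̃₀-even
      where
      with-q̃₀ : Even (evalℤ Q₀ ρ) → Even z
      with-q̃₀ (r , q̃₀≡) = finish (both-even squares)
        where
        w : ℤ
        w = ℤ.- (r ℤ.* q₂ ℤ.+ evalℤ (P₂ :+ S′ :* S′ :* P₄) ρ ℤ.+ (k ℤ.+ k ℤ.* k) ℤ.* (q₂ ℤ.* q₂))
        squares : evalℤ Q₁ ρ ℤ.* evalℤ Q₁ ρ ℤ.+ q₂ ℤ.* q₂ ≡ + 4 ℤ.* w
        squares = ℤ.i-j≡0⇒i≡j _ _ (trans (expand (evalℤ Q₁ ρ) r q₂ (evalℤ P₂ ρ) (evalℤ P₄ ρ) k s s≡ (evalℤ Q₀ ρ) q̃₀≡) middle)
          where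
          -- Shifted coefficients become variables here, so that the equations for s and Q(b) can be
          -- matched with `refl`.
          expand : ∀ q̃₁ r q₂ p̃₂ p̃₄ k s → s ≡ + 1 ℤ.+ + 2 ℤ.* k → ∀ q̃₀ → q̃₀ ≡ + 2 ℤ.* r →
            (q̃₁ ℤ.* q̃₁ ℤ.+ q₂ ℤ.* q₂) ℤ.- + 4 ℤ.* (ℤ.- (r ℤ.* q₂ ℤ.+ (p̃₂ ℤ.+ s ℤ.* s ℤ.* p̃₄) ℤ.+ (k ℤ.+ k ℤ.* k) ℤ.* (q₂ ℤ.* q₂)))
            ≡ q̃₁ ℤ.* q̃₁ ℤ.+ + 2 ℤ.* q̃₀ ℤ.* q₂ ℤ.+ + 4 ℤ.* p̃₂ ℤ.+ s ℤ.* s ℤ.* (q₂ ℤ.* q₂ ℤ.+ + 4 ℤ.* p̃₄)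
          expand q̃₁ r q₂ p̃₂ p̃₄ k _ refl _ refl = identityℤ
            ((q1 :* q1 :+ q2 :* q2) :- κ 4 :* (:- (r' :* q2 :+ (p2 :+ s' :* s' :* p4) :+ (k' :+ k' :* k') :* (q2 :* q2))))
            (q1 :* q1 :+ κ 2 :* (κ 2 :* r') :* q2 :+ κ 4 :* p2 :+ s' :* s' :* (q2 :* q2 :+ κ 4 :* p4)) refl
            (q̃₁ ∷ r ∷ q₂ ∷ p̃₂ ∷ p̃₄ ∷ k ∷ [])
            where
            q1 r' q2 p2 p4 k' s' : Polynomial 6
            q1 = var 0F
            r' = var 1F
            q2 = var 2F
            p2 = var 3F
            p4 = var 4F
            k' = var 5F
            s' = κ 1 :+ κ 2 :* k'
        finish : Even (evalℤ Q₁ ρ) × Even q₂ → Even z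
        finish ((m , q̃₁≡) , (n , q₂≡)) = even-centred₁ {z} s (evalℤ U ρ) (evalℤ V ρ) disc
          (n ℤ.* n ℤ.+ evalℤ P₄ ρ) (+ 2 ℤ.* m ℤ.* n ℤ.+ evalℤ P₃ ρ ℤ.+ evalℤ (S′ :^ 2) ρ)
          (U-lemma q₂≡ (evalℤ P₄ ρ)) (V-lemma q̃₁≡ q₂≡ (evalℤ P₃ ρ) (evalℤ (S′ :^ 2) ρ))
          where
          U-lemma : ∀ {q₂ n} → q₂ ≡ + 2 ℤ.* n → ∀ p̃₄ → q₂ ℤ.* q₂ ℤ.+ + 4 ℤ.* p̃₄ ≡ + 4 ℤ.* (n ℤ.* n ℤ.+ p̃₄)
          U-lemma {n = n} refl p̃₄ = identityℤ (κ 2 :* var 0F :* (κ 2 :* var 0F) :+ κ 4 :* var 1F) (κ 4 :* (var 0F :* var 0F :+ var 1F)) refl (n ∷ p̃₄ ∷ [])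
          V-lemma : ∀ {q̃₁ q₂ m n} → q̃₁ ≡ + 2 ℤ.* m → q₂ ≡ + 2 ℤ.* n → ∀ p̃₃ t →
            + 2 ℤ.* q̃₁ ℤ.* q₂ ℤ.+ + 4 ℤ.* p̃₃ ℤ.+ + 4 ℤ.* t ≡ + 4 ℤ.* (+ 2 ℤ.* m ℤ.* n ℤ.+ p̃₃ ℤ.+ t)
          V-lemma {m = m} {n} refl refl p̃₃ t = identityℤ
            (κ 2 :* (κ 2 :* var 0F) :* (κ 2 :* var 1F) :+ κ 4 :* var 2F :+ κ 4 :* var 3F)
            (κ 4 :* (κ 2 :* var 0F :* var 1F :+ var 2F :+ var 3F)) refl (m ∷ n ∷ p̃₃ ∷ t ∷ [])

    even-disc : Even z
    even-disc = split (parity s)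
      where
      split : Even s ⊎ Odd s → Even z
      split (inj₁ (k , s≡)) = even-centred₀ {z} s (evalℤ U ρ) (evalℤ V ρ) disc k (proj₁ V-even) s≡ (proj₂ V-even)
      split (inj₂ s-odd)    = odd-case s-odd

-- From the roots of the monic polynomial to the centred quintic

monicQuadraticAtRoots : ∀ {n} → (a b c u v : Polynomial n) → Polynomial n
monicQuadraticAtRoots a b c u v = (a :* a :+ u :* a :+ v) :* (b :* b :+ u :* b :+ v) :* (c :* c :+ u :* c :+ v)

-- The discriminant of (x - a)(x - b)(x - c)(x² + ux + v).
monicDisc : ∀ {n} → (a b c u v : Polynomial n) → Polynomial n
monicDisc a b c u v = (differences a b c :* differences a b c)
  :* (monicQuadraticAtRoots a b c u v :* monicQuadraticAtRoots a b c u v) :* (u :* u :- κ 4 :* v)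

genericMonicDisc : Polynomial 5
genericMonicDisc = monicDisc (var 0F) (var 1F) (var 2F) (var 3F) (var 4F)

-- The ratio of the discriminants of 4⁴ f(x / 4) and f.
256³·_ : ℚ → ℚ
256³· x = toℚ (+ 256) * (toℚ (+ 256) * (toℚ (+ 256) * x))

256³·-cancel : ∀ {x y} → 256³· x ≡ 256³· y → x ≡ y
256³·-cancel {x} {y} eq = trans (inverse x) (trans (cong (r * (r * r) *_) eq) (sym (inverse y)))
  where
  r : ℚ
  r = + 1 / 256
  inverse : ∀ x → x ≡ r * (r * r) * 256³· x
  inverse x = trans (sym (ℚ.*-identityˡ x)) (S.solve 2 (λ r x → (r :* κ 256) :* (r :* κ 256) :* (r :* κ 256) :* x S.:=
    (r :* (r :* r)) :* (κ 256 :* (κ 256 :* (κ 256 :* x)))) refl r x)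

-- The quotient of 4⁴ f(x / 4) by (x - a)(x - b)(x - c), read off the coefficients e₄ and 4e₃ of x⁴
-- and x³.
cofactor₁ cofactor₀ : Coeffs ℤ → (a b c : ℤ) → ℤ
cofactor₁ (coeffs _ _ _ _ e₄) a b c = e₄ ℤ.+ (a ℤ.+ b ℤ.+ c)
cofactor₀ e@(coeffs _ _ _ e₃ _) a b c =
  + 4 ℤ.* e₃ ℤ.+ cofactor₁ e a b c ℤ.* (a ℤ.+ b ℤ.+ c) ℤ.- (a ℤ.* b ℤ.+ b ℤ.* c ℤ.+ a ℤ.* c)

record MonicFactors (e : Coeffs ℤ) (z a b c : ℤ) : Set where
  constructor monicFactors
  field
    a≢b    : a ≢ b
    a≢c    : a ≢ c
    b≢c    : b ≢ c
    root-a : monicRoot e a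
    root-b : monicRoot e b
    root-c : monicRoot e c
    disc   : 256³· (toℚ (+ 256) * toℚ z) ≡ ⟦ genericMonicDisc ⟧ (Vec.map toℚ (a ∷ b ∷ c ∷ cofactor₁ e a b c ∷ cofactor₀ e a b c ∷ []))

Quarters : (a b c : ℤ) → Set
Quarters a b c = ∃ λ b′ → ∃ λ s → a ≡ + 4 ℤ.* (b′ ℤ.+ s) × b ≡ + 4 ℤ.* b′ × c ≡ + 4 ℤ.* (b′ ℤ.- s)

-- Two odd roots are impossible, and an even root is divisible by 4.
quarter : ∀ ρ {z a b c} → MonicFactors (coefficients ρ) z a b c → a ℤ.+ c ≡ + 2 ℤ.* b →
  Quarters a b c
quarter ρ {z} {a} {b} {c} F a+c≡2b = by-parity (parity a)
  where
  open MonicFactors F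
  c≡2b-a : c ≡ + 2 ℤ.* b ℤ.- a
  c≡2b-a = trans (identityℤ (var 1F) ((var 0F :+ var 1F) :- var 0F) refl (a ∷ c ∷ [])) (cong (λ t → t ℤ.+ ℤ.- a) a+c≡2b)

  c-odd : ∀ k → a ≡ + 1 ℤ.+ + 2 ℤ.* k → Odd c
  c-odd k refl = b ℤ.- k ℤ.- + 1 , trans c≡2b-a (identityℤ (κ 2 :* var 0F :- (κ 1 :+ κ 2 :* var 1F)) (κ 1 :+ κ 2 :* (var 0F :- var 1F :- κ 1)) refl (b ∷ k ∷ []))

  c-even : ∀ k → a ≡ + 2 ℤ.* k → Even c
  c-even k refl = b ℤ.- k , trans c≡2b-a (identityℤ (κ 2 :* var 0F :- κ 2 :* var 1F) (κ 2 :* (var 0F :- var 1F)) refl (b ∷ k ∷ []))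

  -- Multiples of 4 at both ends make the midpoint b = 2(a′ + c′) even, so `even-root` applies to b
  -- as well.
  four : ∀ a′ c′ → a ≡ + 4 ℤ.* a′ → c ≡ + 4 ℤ.* c′ →
    Quarters a b c
  four a′ c′ a≡ c≡ = finish (even-root ρ root-b (a′ ℤ.+ c′ , halve a≡ c≡))
    where
    halve : a ≡ + 4 ℤ.* a′ → c ≡ + 4 ℤ.* c′ → b ≡ + 2 ℤ.* (a′ ℤ.+ c′)
    halve refl refl = ℤ.*-cancelˡ-≡ (+ 2) b _ (trans (sym a+c≡2b)
      (identityℤ (κ 4 :* var 0F :+ κ 4 :* var 1F) (κ 2 :* (κ 2 :* (var 0F :+ var 1F))) refl (a′ ∷ c′ ∷ [])))
    finish : (∃ λ b′ → b ≡ + 4 ℤ.* b′) → Quarters a b c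
    finish (b′ , b≡) = b′ , a′ ℤ.- b′ , trans a≡ (cong (ℤ._*_ (+ 4)) (recentre a′ b′)) , b≡ , c-side b≡
      where
      recentre : ∀ x y → x ≡ y ℤ.+ (x ℤ.- y)
      recentre x y = identityℤ (var 0F) (var 1F :+ (var 0F :- var 1F)) refl (x ∷ y ∷ [])
      reflect : ∀ x y → + 2 ℤ.* (+ 4 ℤ.* y) ℤ.- + 4 ℤ.* x ≡ + 4 ℤ.* (y ℤ.- (x ℤ.- y))
      reflect x y = identityℤ (κ 2 :* (κ 4 :* var 1F) :- κ 4 :* var 0F) (κ 4 :* (var 1F :- (var 0F :- var 1F))) refl (x ∷ y ∷ [])
      c-side : b ≡ + 4 ℤ.* b′ → c ≡ + 4 ℤ.* (b′ ℤ.- (a′ ℤ.- b′))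
      c-side b≡ = trans c≡2b-a (trans (cong₂ (λ x y → + 2 ℤ.* x ℤ.- y) b≡ a≡) (reflect a′ b′))

  by-parity : Even a ⊎ Odd a → Quarters a b c
  by-parity (inj₂ a-odd@(k , a≡)) = ⊥-elim (odd-roots-⊥ (coefficients ρ) root-a root-c a≢c a-odd (c-odd k a≡))
  by-parity (inj₁ a-even@(k , a≡)) = combine (even-root ρ root-a a-even) (even-root ρ root-c (c-even k a≡))
    where
    combine : (∃ λ a′ → a ≡ + 4 ℤ.* a′) → (∃ λ c′ → c ≡ + 4 ℤ.* c′) → Quarters a b c
    combine (a′ , a≡) (c′ , c≡) = four a′ c′ a≡ c≡

-- Scaling by 4 turns x² + ux + 4v into 4(4x² + ux + v); moving b to the origin then changes u to u
-- + 8b and v to 4b² + ub + v.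
monicDisc-centred : ∀ b s u v →
  ⟦ genericMonicDisc ⟧ (toℚ (+ 4) * (b + s) ∷ toℚ (+ 4) * b ∷ toℚ (+ 4) * (b + - s) ∷ u ∷ toℚ (+ 4) * v ∷ []) ≡
  256³· (⟦ centredDisc (var 0F) (var 1F) (var 2F) ⟧ (s ∷ u + toℚ (+ 8) * b ∷ toℚ (+ 4) * b * b + u * b + v ∷ []))
monicDisc-centred b s u v = polynomial-identity
  (monicDisc (κ 4 :* (B :+ S′)) (κ 4 :* B) (κ 4 :* (B :- S′)) U (κ 4 :* V))
  (κ 256 :* (κ 256 :* (κ 256 :* centredDisc S′ (U :+ κ 8 :* B) (κ 4 :* B :* B :+ U :* B :+ V)))) refl (b ∷ s ∷ u ∷ v ∷ [])
  where
  B S′ U V : Polynomial 4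
  B = var 0F
  S′ = var 1F
  U = var 2F
  V = var 3F

-- The three roots have sum 12b, and their pairwise products add up to 48b² - 16s².
toℚ-cofactors : ∀ e b s → let open Coeffs e ; u = toℚ e₄ + toℚ (+ 12) * toℚ b in
  toℚ (cofactor₁ e (+ 4 ℤ.* (b ℤ.+ s)) (+ 4 ℤ.* b) (+ 4 ℤ.* (b ℤ.- s))) ≡ u ×
  toℚ (cofactor₀ e (+ 4 ℤ.* (b ℤ.+ s)) (+ 4 ℤ.* b) (+ 4 ℤ.* (b ℤ.- s))) ≡
    toℚ (+ 4) * (toℚ e₃ + toℚ (+ 3) * toℚ b * u + - (toℚ (+ 12) * toℚ b * toℚ b) + toℚ (+ 4) * toℚ s * toℚ s)
toℚ-cofactors e b s =
  trans (toℚ-evalℤ u₁ ρ) (polynomial-identity u₁ u₂ refl (Vec.map toℚ ρ)) ,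
  trans (toℚ-evalℤ v₁ ρ) (polynomial-identity v₁ v₂ refl (Vec.map toℚ ρ))
  where
  open Coeffs e
  ρ : Vec ℤ 4
  ρ = e₃ ∷ e₄ ∷ b ∷ s ∷ []
  B S′ X Y Z u₁ u₂ v₁ v₂ : Polynomial 4
  B = var 2F
  S′ = var 3F
  X = κ 4 :* (B :+ S′)
  Y = κ 4 :* B
  Z = κ 4 :* (B :- S′)
  u₁ = var 1F :+ (X :+ Y :+ Z)
  u₂ = var 1F :+ κ 12 :* B
  v₁ = κ 4 :* var 0F :+ u₁ :* (X :+ Y :+ Z) :- (X :* Y :+ Y :* Z :+ X :* Z)
  v₂ = κ 4 :* (var 0F :+ κ 3 :* B :* u₂ :- κ 12 :* B :* B :+ κ 4 :* S′ :* S′)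

vec₅ : ∀ {A : Set} {a b c d e a′ b′ c′ d′ e′ : A} → a ≡ a′ → b ≡ b′ → c ≡ c′ → d ≡ d′ → e ≡ e′ →
  _≡_ {A = Vec A 5} (a ∷ b ∷ c ∷ d ∷ e ∷ []) (a′ ∷ b′ ∷ c′ ∷ d′ ∷ e′ ∷ [])
vec₅ refl refl refl refl refl = refl

module _ (p₀ p₁ p₂ p₃ p₄ q₀ q₁ q₂ : ℤ) where
  private
    ρ₀ : Vec ℤ 8
    ρ₀ = p₀ ∷ p₁ ∷ p₂ ∷ p₃ ∷ p₄ ∷ q₀ ∷ q₁ ∷ q₂ ∷ []

  module _ (b s : ℤ) where
    open Centred p₀ p₁ p₂ p₃ p₄ q₀ q₁ q₂ b s
    open Coeffs (coefficients ρ₀)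
    private module Eₛ = Coeffs E
    private
      ρq : Vec ℚ 10
      ρq = Vec.map toℚ ρ
      u v : ℚ
      u = toℚ e₄ + toℚ (+ 12) * toℚ b
      v = toℚ e₃ + toℚ (+ 3) * toℚ b * u + - (toℚ (+ 12) * toℚ b * toℚ b) + toℚ (+ 4) * toℚ s * toℚ s
      centred : Polynomial 3
      centred = centredDisc (var 0F) (var 1F) (var 2F)

    shifted-u : u + toℚ (+ 8) * toℚ b ≡ toℚ (evalℤ U ρ)
    shifted-u = trans (cong (λ t → t + toℚ (+ 12) * toℚ b + toℚ (+ 8) * toℚ b) (toℚ-evalℤ (Coeffs.e₄ genericSquare) ρ₀))
      (trans (polynomial-identity (Eₛ.e₄ :+ κ 12 :* B :+ κ 8 :* B) U refl ρq) (sym (toℚ-evalℤ U ρ)))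

    shifted-v : toℚ (+ 4) * toℚ b * toℚ b + u * toℚ b + v ≡ toℚ (evalℤ V ρ)
    shifted-v = trans (cong₂ (λ t w → toℚ (+ 4) * toℚ b * toℚ b + (t + toℚ (+ 12) * toℚ b) * toℚ b
          + (w + toℚ (+ 3) * toℚ b * (t + toℚ (+ 12) * toℚ b) + - (toℚ (+ 12) * toℚ b * toℚ b) + toℚ (+ 4) * toℚ s * toℚ s))
        (toℚ-evalℤ (Coeffs.e₄ genericSquare) ρ₀) (toℚ-evalℤ (Coeffs.e₃ genericSquare) ρ₀))
      (trans (polynomial-identity (κ 4 :* B :* B :+ (Eₛ.e₄ :+ κ 12 :* B) :* B
          :+ (Eₛ.e₃ :+ κ 3 :* B :* (Eₛ.e₄ :+ κ 12 :* B) :- κ 12 :* B :* B :+ κ 4 :* S′ :* S′)) V refl ρq) (sym (toℚ-evalℤ V ρ)))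

    centred-disc : ∀ {z} →
      256³· (toℚ (+ 256) * toℚ z) ≡ ⟦ genericMonicDisc ⟧ (Vec.map toℚ (+ 4 ℤ.* (b ℤ.+ s) ∷ + 4 ℤ.* b ∷ + 4 ℤ.* (b ℤ.- s)
        ∷ cofactor₁ (coefficients ρ₀) (+ 4 ℤ.* (b ℤ.+ s)) (+ 4 ℤ.* b) (+ 4 ℤ.* (b ℤ.- s))
        ∷ cofactor₀ (coefficients ρ₀) (+ 4 ℤ.* (b ℤ.+ s)) (+ 4 ℤ.* b) (+ 4 ℤ.* (b ℤ.- s)) ∷ [])) →
      + 256 ℤ.* z ≡ evalℤ centred (s ∷ evalℤ U ρ ∷ evalℤ V ρ ∷ [])
    centred-disc {z} disc = toℚ-injective (trans (toℚ-* (+ 256) z) (trans (256³·-cancel chain)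
        (sym (toℚ-evalℤ centred (s ∷ evalℤ U ρ ∷ evalℤ V ρ ∷ [])))))
      where
      cofactors : _ × _
      cofactors = toℚ-cofactors (coefficients ρ₀) b s
      chain : 256³· (toℚ (+ 256) * toℚ z) ≡ 256³· (⟦ centred ⟧ (toℚ s ∷ toℚ (evalℤ U ρ) ∷ toℚ (evalℤ V ρ) ∷ []))
      chain = trans disc (trans
        (cong ⟦ genericMonicDisc ⟧ {x = Vec.map toℚ (+ 4 ℤ.* (b ℤ.+ s) ∷ + 4 ℤ.* b ∷ + 4 ℤ.* (b ℤ.- s)
              ∷ cofactor₁ (coefficients ρ₀) (+ 4 ℤ.* (b ℤ.+ s)) (+ 4 ℤ.* b) (+ 4 ℤ.* (b ℤ.- s))
              ∷ cofactor₀ (coefficients ρ₀) (+ 4 ℤ.* (b ℤ.+ s)) (+ 4 ℤ.* b) (+ 4 ℤ.* (b ℤ.- s)) ∷ [])}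
            {y = toℚ (+ 4) * (toℚ b + toℚ s) ∷ toℚ (+ 4) * toℚ b ∷ toℚ (+ 4) * (toℚ b + - toℚ s) ∷ u ∷ toℚ (+ 4) * v ∷ []} (vec₅
          (toℚ-evalℤ (κ 4 :* (var 0F :+ var 1F)) (b ∷ s ∷ [])) (toℚ-evalℤ (κ 4 :* var 0F) (b ∷ s ∷ []))
          (toℚ-evalℤ (κ 4 :* (var 0F :- var 1F)) (b ∷ s ∷ [])) (proj₁ cofactors) (proj₂ cofactors)))
        (trans (monicDisc-centred (toℚ b) (toℚ s) u v)
          (cong₂ (λ x y → 256³· (⟦ centred ⟧ (toℚ s ∷ x ∷ y ∷ []))) shifted-u shifted-v)))

    monic-horner : ∀ e {x} → monicRoot e (+ 4 ℤ.* x) → evalℤ (horner coeffVars (var 5F)) (Coeffs.e₀ e ∷ Coeffs.e₁ e ∷ Coeffs.e₂ e ∷ Coeffs.e₃ e ∷ Coeffs.e₄ e ∷ x ∷ []) ≡ + 0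
    monic-horner e {x} eq = ℤ-cancel {+ 256} (λ ()) (trans (sym (identityℤ (monic coeffVars (κ 4 :* var 5F)) (κ 256 :* horner coeffVars (var 5F)) refl
        (Coeffs.e₀ e ∷ Coeffs.e₁ e ∷ Coeffs.e₂ e ∷ Coeffs.e₃ e ∷ Coeffs.e₄ e ∷ x ∷ []))) eq)

  even-of-midpoint : ∀ {z a b c} → MonicFactors (coefficients ρ₀) z a b c → a ℤ.+ c ≡ + 2 ℤ.* b → Even z
  even-of-midpoint {z} F mid = go F (quarter ρ₀ F mid)
    where
    go : ∀ {a b c} → MonicFactors (coefficients ρ₀) z a b c → Quarters a b c → Even z
    go (monicFactors a≢b _ _ root-a root-b root-c disc) (b , s , refl , refl , refl) = even-disc {z} s≢0
      (monic-horner b s (coefficients ρ₀) {b} root-b) (monic-horner b s (coefficients ρ₀) {b ℤ.+ s} root-a) (monic-horner b s (coefficients ρ₀) {b ℤ.- s} root-c)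
      (centred-disc b s {z} disc)
      where
      open Centred p₀ p₁ p₂ p₃ p₄ q₀ q₁ q₂ b s
      s≢0 : s ≢ + 0
      s≢0 refl = a≢b (cong (ℤ._*_ (+ 4)) (ℤ.+-identityʳ b))

-- Root differences as powers of two

module PowersOfTwo where
  open import Data.Integer using (∣_∣)
  open import Induction.WellFounded using (Acc; acc)

  odd-coprime-2 : ∀ {m} → 2 ∤ m → Coprime m 2
  odd-coprime-2 2∤m {d} (d∣m , d∣2) with prime⇒irreducible prime[2] d∣2
  ... | inj₁ d≡1  = d≡1
  ... | inj₂ refl = ⊥-elim (2∤m d∣m)

  strip-2^ : ∀ k {m n} → 2 ∤ m → m ∣ 2 ^ k ℕ.* n → m ∣ n
  strip-2^ zero    {m} {n} 2∤m m∣ = subst (m ∣_) (ℕ.*-identityˡ n) m∣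
  strip-2^ (suc k) {m} {n} 2∤m m∣ = strip-2^ k 2∤m
    (coprime-divisor (odd-coprime-2 2∤m) (subst (m ∣_) (ℕ.*-assoc 2 (2 ^ k) n) m∣))

  strip-256 : ∀ {m n} → 2 ∤ m → m ∣ 256 ℕ.* n → m ∣ n
  strip-256 = strip-2^ 8

  odd-part : ∀ d → .{{_ : NonZero d}} → ∃ λ i → ∃ λ m → d ≡ 2 ^ i ℕ.* m × 2 ∤ m
  odd-part d = go d (<-wellFounded d)
    where
    go : ∀ d → .{{_ : NonZero d}} → Acc ℕ._<_ d → ∃ λ i → ∃ λ m → d ≡ 2 ^ i ℕ.* m × 2 ∤ m
    go d (acc rs) with 2 ∣? d
    ... | no 2∤d = 0 , d , sym (ℕ.*-identityˡ d) , 2∤d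
    ... | yes (divides (suc q) refl) with go (suc q) (rs (ℕ.m<m*n (suc q) 2 (s≤s (s≤s ℕ.z≤n))))
    ...   | i , m , eq , 2∤m = suc i , m , trans (ℕ.*-comm (suc q) 2) (trans (cong (2 ℕ.*_) eq) (sym (ℕ.*-assoc 2 (2 ^ i) m))) , 2∤m

  256⁴·_ : ℕ → ℕ
  256⁴· n = 256 ℕ.* (256 ℕ.* (256 ℕ.* (256 ℕ.* n)))

  strip-256⁴ : ∀ {n m} → 2 ∤ m → m ∣ 256⁴· n → m ∣ n
  strip-256⁴ 2∤m m∣ = strip-256 2∤m (strip-256 2∤m (strip-256 2∤m (strip-256 2∤m m∣)))

  IsPower : ℕ → Set
  IsPower n = ∃ λ i → n ≡ 2 ^ i

  -- The odd part m of d satisfies m² ∣ ℓ, and a prime has no square divisor other than 1.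
  square-divisor : ∀ {d N ℓ} → .{{_ : NonZero d}} → Prime ℓ → (∀ {m} → 2 ∤ m → m ∣ N → m ∣ ℓ) → d ℕ.* d ∣ N → IsPower d
  square-divisor {d} {N} {ℓ} ℓ-prime strip d²∣ with odd-part d
  ... | i , m , d≡ , 2∤m = i , trans d≡ (trans (cong (2 ^ i ℕ.*_) m≡1) (ℕ.*-identityʳ (2 ^ i)))
    where
    2∤m² : 2 ∤ m ℕ.* m
    2∤m² 2∣m² with euclidsLemma m m prime[2] 2∣m²
    ... | inj₁ 2∣m = 2∤m 2∣m
    ... | inj₂ 2∣m = 2∤m 2∣m
    m∣d : m ∣ d
    m∣d = subst (m ∣_) (sym d≡) (n∣m*n (2 ^ i))
    m²∣ℓ : m ℕ.* m ∣ ℓ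
    m²∣ℓ = strip 2∤m² (∣-trans (*-pres-∣ m∣d m∣d) d²∣)
    m≡1 : m ≡ 1
    m≡1 with prime⇒irreducible ℓ-prime (∣-trans (m∣m*n m) m²∣ℓ)
    ... | inj₁ m≡1  = m≡1
    ... | inj₂ refl with prime⇒irreducible ℓ-prime m²∣ℓ
    ...   | inj₁ m²≡1 = ℕ.m*n≡1⇒m≡1 m m m²≡1
    ...   | inj₂ m²≡m = ⊥-elim (not-idempotent m ℓ-prime m²≡m)
      where
      not-idempotent : ∀ m → Prime m → m ℕ.* m ≢ m
      not-idempotent (suc zero)      p _  = ¬prime[1] p
      not-idempotent m@(suc (suc k)) p eq = ℕ.<⇒≢ (ℕ.m<m*n m m (s≤s (s≤s ℕ.z≤n))) (sym eq)

  2∤1 : 2 ∤ 1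
  2∤1 2∣1 with ∣1⇒≡1 2∣1
  ... | ()

  pow-sum₀ : ∀ j k → 1 ℕ.+ 2 ^ suc j ≢ 2 ^ k
  pow-sum₀ j zero    eq with ℕ.m^n≡0⇒m≡0 2 (suc j) (ℕ.suc-injective eq)
  ... | ()
  pow-sum₀ j (suc k) eq = 2∤1 (∣m+n∣m⇒∣n (subst (2 ∣_) (trans (sym eq) (ℕ.+-comm 1 (2 ^ suc j))) (m∣m*n (2 ^ k))) (m∣m*n (2 ^ j)))

  -- Once common factors of two are cancelled, unequal exponents leave 1 + 2^(j + 1), which is odd
  -- and greater than 1.
  pow-sum : ∀ i j k → 2 ^ i ℕ.+ 2 ^ j ≡ 2 ^ k → i ≡ j
  pow-sum zero    zero    k       eq = refl
  pow-sum zero    (suc j) k       eq = ⊥-elim (pow-sum₀ j k eq)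
  pow-sum (suc i) zero    k       eq = ⊥-elim (pow-sum₀ i k (trans (ℕ.+-comm 1 (2 ^ suc i)) eq))
  pow-sum (suc i) (suc j) zero    eq = ⊥-elim (2∤1 (subst (2 ∣_) (trans (ℕ.*-distribˡ-+ 2 (2 ^ i) (2 ^ j)) eq) (m∣m*n (2 ^ i ℕ.+ 2 ^ j))))
  pow-sum (suc i) (suc j) (suc k) eq = cong suc (pow-sum i j k (ℕ.*-cancelˡ-≡ _ _ 2 (trans (ℕ.*-distribˡ-+ 2 (2 ^ i) (2 ^ j)) eq)))

  power-sum : ∀ {m n o} → IsPower m → IsPower n → IsPower o → m ℕ.+ n ≡ o → m ≡ n
  power-sum (i , refl) (j , refl) (k , refl) eq = cong (2 ^_) (pow-sum i j k eq)

  power≢0 : ∀ {m} → IsPower m → m ≢ 0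
  power≢0 (i , refl) eq with ℕ.m^n≡0⇒m≡0 2 i eq
  ... | ()

  abs-cases : ∀ t → t ≡ + ∣ t ∣ ⊎ t ≡ ℤ.- (+ ∣ t ∣)
  abs-cases (+ n)      = inj₁ refl
  abs-cases -[1+ n ]   = inj₂ refl

  -- Sorting the terms by sign gives an equation 2^i + 2^j = 2^k between absolute values, whose
  -- summands agree. For x = a - b and y = b - c the three outcomes tell which of the roots a, b, c
  -- is the midpoint: b, c or a.
  signed-powers : ∀ {X Y W x y} → IsPower X → IsPower Y → IsPower W →
    x ≡ + X ⊎ x ≡ ℤ.- (+ X) → y ≡ + Y ⊎ y ≡ ℤ.- (+ Y) → x ℤ.+ y ≡ + W ⊎ x ℤ.+ y ≡ ℤ.- (+ W) →
    x ≡ y ⊎ x ≡ ℤ.- (y ℤ.+ y) ⊎ y ≡ ℤ.- (x ℤ.+ x)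
  signed-powers {X} {Y} {W} PX PY PW = λ where
      (inj₁ refl) (inj₁ refl) (inj₁ eq) → inj₁ (cong +_ (power-sum PX PY PW (ℤ.+-injective eq)))
      (inj₁ refl) (inj₁ refl) (inj₂ eq) → ⊥-elim (nonzero (move (+ W) eq))
      (inj₂ refl) (inj₂ refl) (inj₁ eq) → ⊥-elim (nonzero (move (+ W) (flip (+ X) (+ Y) eq)))
      (inj₂ refl) (inj₂ refl) (inj₂ eq) → inj₁ (cong (λ t → ℤ.- (+ t)) (power-sum PX PY PW
        (ℤ.+-injective (ℤ.neg-injective (trans (ℤ.neg-distrib-+ (+ X) (+ Y)) eq)))))
      (inj₁ refl) (inj₂ refl) (inj₁ eq) → inj₂ (inj₁ (trans (cong +_ (double PW PY PX (shift X Y W eq))) (two (+ Y))))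
      (inj₁ refl) (inj₂ refl) (inj₂ eq) → inj₂ (inj₂ (cong (λ t → ℤ.- (+ t)) (double PW PX PY (shift Y X W (swap X Y W eq)))))
      (inj₂ refl) (inj₁ refl) (inj₁ eq) → inj₂ (inj₂ (trans (cong +_ (double PW PX PY (shift Y X W (trans (ℤ.+-comm (+ Y) (ℤ.- (+ X))) eq)))) (two (+ X))))
      (inj₂ refl) (inj₁ refl) (inj₂ eq) → inj₂ (inj₁ (cong (λ t → ℤ.- (+ t)) (double PW PY PX
        (shift X Y W (swap Y X W (trans (ℤ.+-comm (+ Y) (ℤ.- (+ X))) eq))))))
    where
    nonzero : + (X ℕ.+ Y ℕ.+ W) ≢ + 0
    nonzero eq = power≢0 PX (ℕ.m+n≡0⇒m≡0 X (ℕ.m+n≡0⇒m≡0 (X ℕ.+ Y) (ℤ.+-injective eq)))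
    move : ∀ w {s} → s ≡ ℤ.- w → s ℤ.+ w ≡ + 0
    move w refl = ℤ.+-inverseˡ w
    flip : ∀ x y {w} → ℤ.- x ℤ.+ ℤ.- y ≡ w → x ℤ.+ y ≡ ℤ.- w
    flip x y refl = trans (sym (ℤ.neg-involutive (x ℤ.+ y))) (cong ℤ.-_ (ℤ.neg-distrib-+ x y))
    shift : ∀ x y w → + x ℤ.+ ℤ.- (+ y) ≡ + w → w ℕ.+ y ≡ x
    shift x y w eq = ℤ.+-injective (trans (cong (ℤ._+ + y) (sym eq)) (identityℤ ((var 0F :- var 1F) :+ var 1F) (var 0F) refl (+ x ∷ + y ∷ [])))
    swap : ∀ x y w → + x ℤ.+ ℤ.- (+ y) ≡ ℤ.- (+ w) → + y ℤ.+ ℤ.- (+ x) ≡ + w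
    swap x y w eq = trans (identityℤ (var 1F :- var 0F) (:- (var 0F :- var 1F)) refl (+ x ∷ + y ∷ [])) (trans (cong ℤ.-_ eq) (ℤ.neg-involutive (+ w)))
    two : ∀ y → y ℤ.+ y ≡ ℤ.- (ℤ.- y ℤ.+ ℤ.- y)
    two y = identityℤ (var 0F :+ var 0F) (:- (:- var 0F :+ :- var 0F)) refl (y ∷ [])
    double : ∀ {m n o} → IsPower m → IsPower n → IsPower o → m ℕ.+ n ≡ o → o ≡ n ℕ.+ n
    double {n = n} Pm Pn Po eq = trans (sym eq) (cong (ℕ._+ n) (power-sum Pm Pn Po eq))

  square-factor : ∀ {x m z} → 256³· (toℚ (+ 256) * toℚ z) ≡ toℚ x * toℚ x * toℚ m → ∣ x ∣ ℕ.* ∣ x ∣ ∣ 256⁴· ∣ z ∣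
  square-factor {x} {m} {z} eq = divides ∣ m ∣ (begin
    256⁴· ∣ z ∣                                           ≡⟨ sym (abs-256 (t₃ z) (abs-256 (t₂ z) (abs-256 (t₁ z) (abs-256 z refl)))) ⟩
    ∣ + 256 ℤ.* t₃ z ∣                                    ≡⟨ cong ∣_∣ integral ⟩
    ∣ x ℤ.* x ℤ.* m ∣                                     ≡⟨ ℤ.abs-* (x ℤ.* x) m ⟩
    ∣ x ℤ.* x ∣ ℕ.* ∣ m ∣                                 ≡⟨ cong (ℕ._* ∣ m ∣) (ℤ.abs-* x x) ⟩
    ∣ x ∣ ℕ.* ∣ x ∣ ℕ.* ∣ m ∣                             ≡⟨ ℕ.*-comm (∣ x ∣ ℕ.* ∣ x ∣) ∣ m ∣ ⟩
    ∣ m ∣ ℕ.* (∣ x ∣ ℕ.* ∣ x ∣)                           ∎)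
    where
    open ≡-Reasoning
    t₁ t₂ t₃ : ℤ → ℤ
    t₁ t = + 256 ℤ.* t
    t₂ t = + 256 ℤ.* t₁ t
    t₃ t = + 256 ℤ.* t₂ t
    abs-256 : ∀ t {n} → ∣ t ∣ ≡ n → ∣ + 256 ℤ.* t ∣ ≡ 256 ℕ.* n
    abs-256 t refl = ℤ.abs-* (+ 256) t
    integral : + 256 ℤ.* t₃ z ≡ x ℤ.* x ℤ.* m
    integral = toℚ-injective (trans
      (toℚ-256 (t₃ z) (toℚ-256 (t₂ z) (toℚ-256 (t₁ z) (toℚ-256 z refl))))
      (trans eq (sym (trans (toℚ-* (x ℤ.* x) m) (cong (_* toℚ m) (toℚ-* x x))))))
      where
      toℚ-256 : ∀ t {s} → toℚ t ≡ s → toℚ (+ 256 ℤ.* t) ≡ toℚ (+ 256) * s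
      toℚ-256 t refl = toℚ-* (+ 256) t

  module _ {e z a b c} (F : MonicFactors e z a b c) where
    open MonicFactors F
    private
      ρ : Vec ℤ 5
      ρ = a ∷ b ∷ c ∷ cofactor₁ e a b c ∷ cofactor₀ e a b c ∷ []
      ρq : Vec ℚ 5
      ρq = Vec.map toℚ ρ
      A B C G W : Polynomial 5
      A = var 0F
      B = var 1F
      C = var 2F
      G = monicQuadraticAtRoots A B C (var 3F) (var 4F)
      W = var 3F :* var 3F :- κ 4 :* var 4F

      factor : (x y : Polynomial 5) →
        ⟦ genericMonicDisc ⟧ ρq ≡ ⟦ x ⟧ ρq * ⟦ x ⟧ ρq * ⟦ y :* y :* (G :* G) :* W ⟧ ρq →
        ∣ evalℤ x ρ ∣ ℕ.* ∣ evalℤ x ρ ∣ ∣ 256⁴· ∣ z ∣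
      factor x y eq = square-factor {evalℤ x ρ} {evalℤ (y :* y :* (G :* G) :* W) ρ} {z} (trans disc (trans eq
        (sym (cong₂ (λ s t → s * s * t) (toℚ-evalℤ x ρ) (toℚ-evalℤ (y :* y :* (G :* G) :* W) ρ)))))

    module _ (z-prime : Prime ∣ z ∣) where
      private
        nonZero : ∀ {x y} → x ≢ y → NonZero ∣ x ℤ.- y ∣
        nonZero x≢y = ℕ.≢-nonZero (λ eq → minus≢0 x≢y (ℤ.∣i∣≡0⇒i≡0 eq))

        P Q R : Polynomial 5
        P = A :- B
        Q = A :- C
        R = B :- C

      power-ab : IsPower ∣ a ℤ.- b ∣
      power-ab = square-divisor {{nonZero a≢b}} z-prime (strip-256⁴ {∣ z ∣}) (factor P (Q :* R)
        (S.solve 5 (λ p q r g w → (p :* q :* r :* (p :* q :* r)) :* (g :* g) :* w S.:= p :* p :* ((q :* r) :* (q :* r) :* (g :* g) :* w)) refl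
          (⟦ P ⟧ ρq) (⟦ Q ⟧ ρq) (⟦ R ⟧ ρq) (⟦ G ⟧ ρq) (⟦ W ⟧ ρq)))

      power-ac : IsPower ∣ a ℤ.- c ∣
      power-ac = square-divisor {{nonZero a≢c}} z-prime (strip-256⁴ {∣ z ∣}) (factor Q (P :* R)
        (S.solve 5 (λ p q r g w → (p :* q :* r :* (p :* q :* r)) :* (g :* g) :* w S.:= q :* q :* ((p :* r) :* (p :* r) :* (g :* g) :* w)) refl
          (⟦ P ⟧ ρq) (⟦ Q ⟧ ρq) (⟦ R ⟧ ρq) (⟦ G ⟧ ρq) (⟦ W ⟧ ρq)))

      power-bc : IsPower ∣ b ℤ.- c ∣
      power-bc = square-divisor {{nonZero b≢c}} z-prime (strip-256⁴ {∣ z ∣}) (factor R (P :* Q)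
        (S.solve 5 (λ p q r g w → (p :* q :* r :* (p :* q :* r)) :* (g :* g) :* w S.:= r :* r :* ((p :* q) :* (p :* q) :* (g :* g) :* w)) refl
          (⟦ P ⟧ ρq) (⟦ Q ⟧ ρq) (⟦ R ⟧ ρq) (⟦ G ⟧ ρq) (⟦ W ⟧ ρq)))

      midpoint : a ℤ.+ c ≡ + 2 ℤ.* b ⊎ a ℤ.+ b ≡ + 2 ℤ.* c ⊎ b ℤ.+ c ≡ + 2 ℤ.* a
      midpoint = cases (signed-powers power-ab power-bc power-ac (abs-cases (a ℤ.- b)) (abs-cases (b ℤ.- c))
          (subst (λ t → t ≡ + ∣ a ℤ.- c ∣ ⊎ t ≡ ℤ.- (+ ∣ a ℤ.- c ∣)) (telescope a b c) (abs-cases (a ℤ.- c))))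
        where
        telescope : ∀ a b c → a ℤ.- c ≡ (a ℤ.- b) ℤ.+ (b ℤ.- c)
        telescope a b c = identityℤ (var 0F :- var 2F) ((var 0F :- var 1F) :+ (var 1F :- var 2F)) refl (a ∷ b ∷ c ∷ [])
        cases : a ℤ.- b ≡ b ℤ.- c ⊎ a ℤ.- b ≡ ℤ.- ((b ℤ.- c) ℤ.+ (b ℤ.- c)) ⊎ b ℤ.- c ≡ ℤ.- ((a ℤ.- b) ℤ.+ (a ℤ.- b)) →
          a ℤ.+ c ≡ + 2 ℤ.* b ⊎ a ℤ.+ b ≡ + 2 ℤ.* c ⊎ b ℤ.+ c ≡ + 2 ℤ.* a
        cases (inj₁ eq)        = inj₁ (ℤ.i-j≡0⇒i≡j _ _ (trans
          (identityℤ ((A :+ C) :- κ 2 :* B) ((A :- B) :- (B :- C)) refl ρ) (ℤ.i≡j⇒i-j≡0 eq)))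
        cases (inj₂ (inj₁ eq)) = inj₂ (inj₁ (ℤ.i-j≡0⇒i≡j _ _ (trans
          (identityℤ ((A :+ B) :- κ 2 :* C) ((A :- B) :- :- ((B :- C) :+ (B :- C))) refl ρ) (ℤ.i≡j⇒i-j≡0 eq))))
        cases (inj₂ (inj₂ eq)) = inj₂ (inj₂ (ℤ.i-j≡0⇒i≡j _ _ (trans
          (identityℤ ((B :+ C) :- κ 2 :* A) (:- ((A :- B) :+ (A :- B)) :- (B :- C)) refl ρ) (ℤ.i≡j⇒i-j≡0 (sym eq)))))

  monicDisc-permute : ∀ (a b c a′ b′ c′ u v : ℚ) →
    (a + - b) * (a + - c) * (b + - c) * ((a + - b) * (a + - c) * (b + - c)) ≡ (a′ + - b′) * (a′ + - c′) * (b′ + - c′) * ((a′ + - b′) * (a′ + - c′) * (b′ + - c′)) →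
    ⟦ monicQuadraticAtRoots (var 0F) (var 1F) (var 2F) (var 3F) (var 4F) ⟧ (a ∷ b ∷ c ∷ u ∷ v ∷ []) ≡
    ⟦ monicQuadraticAtRoots (var 0F) (var 1F) (var 2F) (var 3F) (var 4F) ⟧ (a′ ∷ b′ ∷ c′ ∷ u ∷ v ∷ []) →
    ⟦ genericMonicDisc ⟧ (a ∷ b ∷ c ∷ u ∷ v ∷ []) ≡ ⟦ genericMonicDisc ⟧ (a′ ∷ b′ ∷ c′ ∷ u ∷ v ∷ [])
  monicDisc-permute a b c a′ b′ c′ u v δ γ = cong₂ (λ x y → x * (y * y) * (u * u + - (toℚ (+ 4) * v))) δ γ

  module _ {e z a b c} (F : MonicFactors e z a b c) where
    open MonicFactors F
    open Coeffs e
    private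
      A B C U V : ∀ {n} → Polynomial (5 ℕ.+ n)
      A = var 0F
      B = var 1F
      C = var 2F
      U = var 3F
      V = var 4F

      permuted : ∀ a′ b′ c′ {u v} → cofactor₁ e a b c ≡ u → cofactor₀ e a b c ≡ v →
        (∀ u v → ⟦ genericMonicDisc ⟧ (toℚ a ∷ toℚ b ∷ toℚ c ∷ u ∷ v ∷ []) ≡ ⟦ genericMonicDisc ⟧ (toℚ a′ ∷ toℚ b′ ∷ toℚ c′ ∷ u ∷ v ∷ [])) →
        256³· (toℚ (+ 256) * toℚ z) ≡ ⟦ genericMonicDisc ⟧ (Vec.map toℚ (a′ ∷ b′ ∷ c′ ∷ u ∷ v ∷ []))
      permuted a′ b′ c′ refl refl eq = trans disc (eq (toℚ (cofactor₁ e a b c)) (toℚ (cofactor₀ e a b c)))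

    -- Any of the three roots may be the midpoint; this swap and `swap₁₂` bring it to the middle
    -- position.
    swap₂₃ : MonicFactors e z a c b
    swap₂₃ = monicFactors a≢c a≢b (λ eq → b≢c (sym eq)) root-a root-c root-b (permuted a c b
      (identityℤ (U :+ (A :+ B :+ C)) (U :+ (A :+ C :+ B)) refl (a ∷ b ∷ c ∷ e₄ ∷ e₃ ∷ []))
      (identityℤ (κ 4 :* V :+ (U :+ (A :+ B :+ C)) :* (A :+ B :+ C) :- (A :* B :+ B :* C :+ A :* C))
                 (κ 4 :* V :+ (U :+ (A :+ C :+ B)) :* (A :+ C :+ B) :- (A :* C :+ C :* B :+ A :* B)) refl (a ∷ b ∷ c ∷ e₄ ∷ e₃ ∷ []))
      λ u v → monicDisc-permute (toℚ a) (toℚ b) (toℚ c) (toℚ a) (toℚ c) (toℚ b) u v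
        (polynomial-identity (differences A B C :* differences A B C) (differences A C B :* differences A C B) refl (toℚ a ∷ toℚ b ∷ toℚ c ∷ u ∷ v ∷ []))
        (polynomial-identity (monicQuadraticAtRoots A B C U V) (monicQuadraticAtRoots A C B U V) refl (toℚ a ∷ toℚ b ∷ toℚ c ∷ u ∷ v ∷ [])))

    swap₁₂ : MonicFactors e z b a c
    swap₁₂ = monicFactors (λ eq → a≢b (sym eq)) b≢c a≢c root-b root-a root-c (permuted b a c
      (identityℤ (U :+ (A :+ B :+ C)) (U :+ (B :+ A :+ C)) refl (a ∷ b ∷ c ∷ e₄ ∷ e₃ ∷ []))
      (identityℤ (κ 4 :* V :+ (U :+ (A :+ B :+ C)) :* (A :+ B :+ C) :- (A :* B :+ B :* C :+ A :* C))
                 (κ 4 :* V :+ (U :+ (B :+ A :+ C)) :* (B :+ A :+ C) :- (B :* A :+ A :* C :+ B :* C)) refl (a ∷ b ∷ c ∷ e₄ ∷ e₃ ∷ []))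
      λ u v → monicDisc-permute (toℚ a) (toℚ b) (toℚ c) (toℚ b) (toℚ a) (toℚ c) u v
        (polynomial-identity (differences A B C :* differences A B C) (differences B A C :* differences B A C) refl (toℚ a ∷ toℚ b ∷ toℚ c ∷ u ∷ v ∷ []))
        (polynomial-identity (monicQuadraticAtRoots A B C U V) (monicQuadraticAtRoots B A C U V) refl (toℚ a ∷ toℚ b ∷ toℚ c ∷ u ∷ v ∷ [])))

  even-disc-value : ∀ p₀ p₁ p₂ p₃ p₄ q₀ q₁ q₂ {z a b c} →
    MonicFactors (coefficients (p₀ ∷ p₁ ∷ p₂ ∷ p₃ ∷ p₄ ∷ q₀ ∷ q₁ ∷ q₂ ∷ [])) z a b c → Prime ∣ z ∣ → 2 ∣ ∣ z ∣
  even-disc-value p₀ p₁ p₂ p₃ p₄ q₀ q₁ q₂ {z} {a} {b} {c} F z-prime = divide (cases (midpoint F z-prime))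
    where
    even = even-of-midpoint p₀ p₁ p₂ p₃ p₄ q₀ q₁ q₂
    cases : a ℤ.+ c ≡ + 2 ℤ.* b ⊎ a ℤ.+ b ≡ + 2 ℤ.* c ⊎ b ℤ.+ c ≡ + 2 ℤ.* a → Even z
    cases (inj₁ eq)        = even F eq
    cases (inj₂ (inj₁ eq)) = even (swap₂₃ F) eq
    cases (inj₂ (inj₂ eq)) = even (swap₁₂ F) eq
    divide : Even z → 2 ∣ ∣ z ∣
    divide (k , refl) = divides ∣ k ∣ (trans (ℤ.abs-* (+ 2) k) (ℕ.*-comm 2 ∣ k ∣))

open PowersOfTwo
open import Data.Rational using (∣_∣)

-- Rational Weierstrass points

clear-denominator : ∀ n d-1 .(c : Coprime ℤ.∣ n ∣ (suc d-1)) → mkℚ n d-1 c * toℚ (+ suc d-1) ≡ toℚ n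
clear-denominator n d-1 c = ℚ.toℚᵘ-injective (begin
  toℚᵘ (mkℚ n d-1 c * toℚ (+ suc d-1))        ≈⟨ ℚ.toℚᵘ-homo-* (mkℚ n d-1 c) (toℚ (+ suc d-1)) ⟩
  mkℚᵘ n d-1 ℚᵘ.* toℚᵘ (toℚ (+ suc d-1))      ≈⟨ ℚᵘ.*-cong (ℚᵘ.≃-refl {mkℚᵘ n d-1}) (toℚᵘ-toℚ (+ suc d-1)) ⟩
  mkℚᵘ n d-1 ℚᵘ.* mkℚᵘ (+ suc d-1) 0          ≈⟨ *≡* (trans (ℤ.*-identityʳ _) (cong (λ t → n ℤ.* + t) (sym (ℕ.*-identityʳ (suc d-1))))) ⟩
  mkℚᵘ n 0                                    ≈⟨ ℚᵘ.≃-sym (toℚᵘ-toℚ n) ⟩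
  toℚᵘ (toℚ n)                                ∎)
  where open ℚᵘ.≃-Reasoning

coprime-power : ∀ {d} n k → Coprime d ℤ.∣ n ∣ → d ∣ ℤ.∣ evalℤ (var 0F :^ k) (n ∷ []) ∣ → d ≡ 1
coprime-power n zero    c d∣ = ∣1⇒≡1 d∣
coprime-power n (suc k) c d∣ = coprime-power n k c (coprime-divisor c (subst (_ ∣_) (ℤ.abs-* n _) d∣))

-- The rational root theorem: clearing denominators in X = n / D leaves n⁵ + D · (...) = 0, so D
-- divides n⁵ while being coprime to n.
integralRoot : ∀ e X → let open Coeffs e in
  ⟦ monic coeffVars (var 5F) ⟧ (toℚ e₀ ∷ toℚ e₁ ∷ toℚ e₂ ∷ toℚ e₃ ∷ toℚ e₄ ∷ X ∷ []) ≡ 0ℚ → ∃ λ A → X ≡ toℚ A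
integralRoot e X@(mkℚ n d-1 c) root = n , trans (sym (ℚ.↥p/↧p≡p X)) (ℚ./-cong {p₁ = n} {q₁ = suc d-1} {p₂ = n} {q₂ = 1} refl d≡1)
  where
  open Coeffs e
  D : ℤ
  D = + suc d-1
  ρ : Vec ℤ 7
  ρ = e₀ ∷ e₁ ∷ e₂ ∷ e₃ ∷ e₄ ∷ n ∷ D ∷ []
  N Y R : Polynomial 7
  N = var 5F
  Y = var 6F
  cofactor : Polynomial 7 → Polynomial 7
  cofactor N = var 4F :* N :^ 4 :+ κ 4 :* var 3F :* N :^ 3 :* Y :+ κ 16 :* var 2F :* N :^ 2 :* Y :^ 2 :+ κ 64 :* var 1F :* N :* Y :^ 3 :+ κ 256 :* var 0F :* Y :^ 4
  R = N :^ 5 :+ Y :* cofactor N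
  homogeneous : ⟦ R ⟧ (Vec.map toℚ ρ) ≡ 0ℚ
  homogeneous = trans (cong (λ t → ⟦ R ⟧ (toℚ e₀ ∷ toℚ e₁ ∷ toℚ e₂ ∷ toℚ e₃ ∷ toℚ e₄ ∷ t ∷ toℚ D ∷ [])) (sym (clear-denominator n d-1 c)))
    (trans (polynomial-identity ((N :* Y) :^ 5 :+ Y :* cofactor (N :* Y)) (Y :^ 5 :* monic coeffVars N) refl (toℚ e₀ ∷ toℚ e₁ ∷ toℚ e₂ ∷ toℚ e₃ ∷ toℚ e₄ ∷ X ∷ toℚ D ∷ []))
    (trans (cong (⟦ Y :^ 5 ⟧ (toℚ e₀ ∷ toℚ e₁ ∷ toℚ e₂ ∷ toℚ e₃ ∷ toℚ e₄ ∷ X ∷ toℚ D ∷ []) *_) root)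
      (ℚ.*-zeroʳ (⟦ Y :^ 5 ⟧ (toℚ e₀ ∷ toℚ e₁ ∷ toℚ e₂ ∷ toℚ e₃ ∷ toℚ e₄ ∷ X ∷ toℚ D ∷ [])))))
  equation : evalℤ R ρ ≡ + 0
  equation = toℚ-injective (trans (toℚ-evalℤ R ρ) homogeneous)
  divisible : ∀ {s t} → s ℤ.+ D ℤ.* t ≡ + 0 → suc d-1 ∣ ℤ.∣ s ∣
  divisible {s} {t} eq = divides ℤ.∣ t ∣ (trans (cong ℤ.∣_∣ (trans (identityℤ (var 0F) ((var 0F :+ var 1F) :- var 1F) refl (s ∷ D ℤ.* t ∷ []))
      (trans (cong (λ x → x ℤ.+ ℤ.- (D ℤ.* t)) eq) (ℤ.+-identityˡ (ℤ.- (D ℤ.* t))))))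
    (trans (ℤ.∣-i∣≡∣i∣ (D ℤ.* t)) (trans (ℤ.abs-* D t) (ℕ.*-comm (suc d-1) ℤ.∣ t ∣))))
  d≡1 : suc d-1 ≡ 1
  d≡1 = coprime-power n 5 (Coprimality.sym (Coprimality.recompute c)) (divisible {evalℤ (N :^ 5) ρ} {evalℤ (cofactor N) ρ} equation)

module Curve (p₀ p₁ p₂ p₃ p₄ q₀ q₁ q₂ : ℤ) where
  p : Vec ℤ 5
  p = p₀ ∷ p₁ ∷ p₂ ∷ p₃ ∷ p₄ ∷ []
  q : Vec ℤ 3
  q = q₀ ∷ q₁ ∷ q₂ ∷ []
  e : Coeffs ℤ
  e = coefficients (p Vec.++ q)
  module eℤ = Coeffs e
  eq : Coeffs ℚ
  eq = Equation.e p q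
  module eℚ = Coeffs eq
  ρ : Vec ℚ 8
  ρ = Equation.ρ p q

  toℚ-e : (toℚ eℤ.e₀ ≡ eℚ.e₀) × (toℚ eℤ.e₁ ≡ eℚ.e₁) × (toℚ eℤ.e₂ ≡ eℚ.e₂) × (toℚ eℤ.e₃ ≡ eℚ.e₃) × (toℚ eℤ.e₄ ≡ eℚ.e₄)
  toℚ-e = toℚ-evalℤ (Coeffs.e₀ genericSquare) (p Vec.++ q) , toℚ-evalℤ (Coeffs.e₁ genericSquare) (p Vec.++ q) , toℚ-evalℤ (Coeffs.e₂ genericSquare) (p Vec.++ q)
    , toℚ-evalℤ (Coeffs.e₃ genericSquare) (p Vec.++ q) , toℚ-evalℤ (Coeffs.e₄ genericSquare) (p Vec.++ q)

  monic-value : ∀ {x} → value eq x ≡ 0ℚ → ⟦ monic coeffVars (var 5F) ⟧ (toℚ eℤ.e₀ ∷ toℚ eℤ.e₁ ∷ toℚ eℤ.e₂ ∷ toℚ eℤ.e₃ ∷ toℚ eℤ.e₄ ∷ toℚ (+ 4) * x ∷ []) ≡ 0ℚ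
  monic-value {x} root = trans (rewrite-e toℚ-e) (trans
      (polynomial-identity (monic coeffVars (κ 4 :* var 5F)) (κ 256 :* horner coeffVars (var 5F)) refl (eℚ.e₀ ∷ eℚ.e₁ ∷ eℚ.e₂ ∷ eℚ.e₃ ∷ eℚ.e₄ ∷ x ∷ []))
      (trans (cong (toℚ (+ 256) *_) root) (ℚ.*-zeroʳ (toℚ (+ 256)))))
    where
    rewrite-e : ∀ {a b c d f a′ b′ c′ d′ f′ : ℚ} → (a ≡ a′) × (b ≡ b′) × (c ≡ c′) × (d ≡ d′) × (f ≡ f′) →
      ⟦ monic coeffVars (var 5F) ⟧ (a ∷ b ∷ c ∷ d ∷ f ∷ toℚ (+ 4) * x ∷ []) ≡ ⟦ monic coeffVars (var 5F) ⟧ (a′ ∷ b′ ∷ c′ ∷ d′ ∷ f′ ∷ toℚ (+ 4) * x ∷ [])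
    rewrite-e (refl , refl , refl , refl , refl) = refl

  IntegralRoot : ℚ → Set
  IntegralRoot x = ∃ λ A → (toℚ (+ 4) * x ≡ toℚ A) × monicRoot e A

  integral-root : ∀ {x} → value eq x ≡ 0ℚ → IntegralRoot x
  integral-root {x} root = go (integralRoot e (toℚ (+ 4) * x) (monic-value {x} root))
    where
    go : (∃ λ A → toℚ (+ 4) * x ≡ toℚ A) → IntegralRoot x
    go (A , 4x≡A) = A , 4x≡A , toℚ-injective (trans (toℚ-evalℤ (monic coeffVars (var 5F)) (eℤ.e₀ ∷ eℤ.e₁ ∷ eℤ.e₂ ∷ eℤ.e₃ ∷ eℤ.e₄ ∷ A ∷ []))
      (trans (cong (λ t → ⟦ monic coeffVars (var 5F) ⟧ (toℚ eℤ.e₀ ∷ toℚ eℤ.e₁ ∷ toℚ eℤ.e₂ ∷ toℚ eℤ.e₃ ∷ toℚ eℤ.e₄ ∷ t ∷ [])) (sym 4x≡A)) (monic-value {x} root)))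

  record Roots : Set where
    constructor roots
    field
      {a b c} : ℚ
      a≢b : a ≢ b
      a≢c : a ≢ c
      b≢c : b ≢ c
      fa : value eq a ≡ 0ℚ
      fb : value eq b ≡ 0ℚ
      fc : value eq c ≡ 0ℚ

  u v : (a b c : ℚ) → ℚ
  u a b c = ⟦ cofactorU coeffVars₈ (var 5F) (var 6F) (var 7F) ⟧ (eℚ.e₀ ∷ eℚ.e₁ ∷ eℚ.e₂ ∷ eℚ.e₃ ∷ eℚ.e₄ ∷ a ∷ b ∷ c ∷ [])
  v a b c = ⟦ cofactorV coeffVars₈ (var 5F) (var 6F) (var 7F) ⟧ (eℚ.e₀ ∷ eℚ.e₁ ∷ eℚ.e₂ ∷ eℚ.e₃ ∷ eℚ.e₄ ∷ a ∷ b ∷ c ∷ [])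

  -- Under x ↦ x / 4 the quotient 4x² + ux + v becomes (x² + ux + 4v) / 4.
  cofactors : ∀ {a b c A B C} → toℚ (+ 4) * a ≡ toℚ A → toℚ (+ 4) * b ≡ toℚ B → toℚ (+ 4) * c ≡ toℚ C →
    (toℚ (cofactor₁ e A B C) ≡ u a b c) × (toℚ (cofactor₀ e A B C) ≡ toℚ (+ 4) * v a b c)
  cofactors {a} {b} {c} {A} {B} {C} a≡ b≡ c≡ =
    trans (toℚ-evalℤ u₁ ρℤ) (trans (cong (⟦ u₁ ⟧) vec) (polynomial-identity u₂ u₃ refl ρ₅)) ,
    trans (toℚ-evalℤ v₁ ρℤ) (trans (cong (⟦ v₁ ⟧) vec) (polynomial-identity v₂ v₃ refl ρ₅))
    where
    ρℤ : Vec ℤ 5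
    ρℤ = eℤ.e₃ ∷ eℤ.e₄ ∷ A ∷ B ∷ C ∷ []
    ρ₅ : Vec ℚ 5
    ρ₅ = eℚ.e₃ ∷ eℚ.e₄ ∷ a ∷ b ∷ c ∷ []
    vec : Vec.map toℚ ρℤ ≡ eℚ.e₃ ∷ eℚ.e₄ ∷ toℚ (+ 4) * a ∷ toℚ (+ 4) * b ∷ toℚ (+ 4) * c ∷ []
    vec = vec₅ (toℚ-evalℤ (Coeffs.e₃ genericSquare) (p Vec.++ q)) (toℚ-evalℤ (Coeffs.e₄ genericSquare) (p Vec.++ q)) (sym a≡) (sym b≡) (sym c≡)
    σ₁ τ₁ : (x y z : Polynomial 5) → Polynomial 5
    σ₁ x y z = x :+ y :+ z
    τ₁ x y z = x :* y :+ y :* z :+ x :* z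
    uu vv : (x y z : Polynomial 5) → Polynomial 5
    uu x y z = var 1F :+ σ₁ x y z
    vv x y z = κ 4 :* var 0F :+ uu x y z :* σ₁ x y z :- τ₁ x y z
    X Y Z u₁ u₂ u₃ v₁ v₂ v₃ : Polynomial 5
    X = var 2F
    Y = var 3F
    Z = var 4F
    u₁ = uu X Y Z
    v₁ = vv X Y Z
    u₂ = uu (κ 4 :* X) (κ 4 :* Y) (κ 4 :* Z)
    v₂ = vv (κ 4 :* X) (κ 4 :* Y) (κ 4 :* Z)
    u₃ = var 1F :+ κ 4 :* σ₁ X Y Z
    v₃ = κ 4 :* (var 0F :+ u₃ :* σ₁ X Y Z :- κ 4 :* τ₁ X Y Z)

  -- The product of differences and the product of quadratic values each gain 4³ = 64, both enter
  -- squared, and 64⁴ = 256³.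
  monicDisc-scale : ∀ a b c u v → 256³· (⟦ genericRootDisc ⟧ (a ∷ b ∷ c ∷ u ∷ v ∷ [])) ≡
    ⟦ genericMonicDisc ⟧ (toℚ (+ 4) * a ∷ toℚ (+ 4) * b ∷ toℚ (+ 4) * c ∷ u ∷ toℚ (+ 4) * v ∷ [])
  monicDisc-scale a b c u v = trans
    (S.solve 3 (λ δ γ w → κ 256 :* (κ 256 :* (κ 256 :* ((δ :* δ) :* (γ :* γ) :* w))) S.:=
        ((κ 64 :* δ) :* (κ 64 :* δ)) :* ((κ 64 :* γ) :* (κ 64 :* γ)) :* w) refl
      (⟦ differences A B C ⟧ ρ₅) (⟦ quadraticAtRoots U V A B C ⟧ ρ₅) (⟦ U :* U :- κ 16 :* V ⟧ ρ₅))
    (combine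
      (polynomial-identity (κ 64 :* differences A B C) (differences (κ 4 :* A) (κ 4 :* B) (κ 4 :* C)) refl ρ₅)
      (polynomial-identity (κ 64 :* quadraticAtRoots U V A B C) (monicQuadraticAtRoots (κ 4 :* A) (κ 4 :* B) (κ 4 :* C) U (κ 4 :* V)) refl ρ₅)
      (polynomial-identity (U :* U :- κ 16 :* V) (U :* U :- κ 4 :* (κ 4 :* V)) refl ρ₅))
    where
    A B C U V : Polynomial 5
    A = var 0F
    B = var 1F
    C = var 2F
    U = var 3F
    V = var 4F
    ρ₅ : Vec ℚ 5
    ρ₅ = a ∷ b ∷ c ∷ u ∷ v ∷ []
    combine : ∀ {x y z x′ y′ z′ : ℚ} → x ≡ x′ → y ≡ y′ → z ≡ z′ → (x * x) * (y * y) * z ≡ (x′ * x′) * (y′ * y′) * z′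
    combine refl refl refl = refl

  factors : ∀ {D z} (r : Roots) → let open Roots r in
    toℚ (+ 256) * D ≡ ⟦ genericRootDisc ⟧ (a ∷ b ∷ c ∷ u a b c ∷ v a b c ∷ []) → D ≡ toℚ z →
    ∃ λ A → ∃ λ B → ∃ λ C → MonicFactors e z A B C
  factors {D} {z} r disc refl = go (integral-root {a} fa) (integral-root {b} fb) (integral-root {c} fc)
    where
    open Roots r
    distinct : ∀ x y {X Y} → toℚ (+ 4) * x ≡ toℚ X → toℚ (+ 4) * y ≡ toℚ Y → x ≢ y → X ≢ Y
    distinct x y {X} x≡ y≡ x≢y refl = 1≢0 (ℚ-cancel {toℚ (+ 4) * (x + - y)} {1ℚ} (λ eq → ℚ-minus≢0 x≢y (ℚ-cancel {toℚ (+ 4)} (λ ()) eq))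
        (trans (S.solve 2 (λ x y → κ 4 :* (x :- y) :* κ 1 S.:= κ 4 :* x :- κ 4 :* y) refl x y)
          (trans (cong₂ (λ s t → s + - t) x≡ y≡) (ℚ.+-inverseʳ (toℚ X)))))
      where
      1≢0 : 1ℚ ≢ 0ℚ
      1≢0 ()
    go : IntegralRoot a → IntegralRoot b → IntegralRoot c → ∃ λ A → ∃ λ B → ∃ λ C → MonicFactors e z A B C
    go (A , a≡ , ra) (B , b≡ , rb) (C , c≡ , rc) = A , B , C , monicFactors (distinct a b a≡ b≡ a≢b) (distinct a c a≡ c≡ a≢c) (distinct b c b≡ c≡ b≢c) ra rb rc
      (trans (cong 256³·_ disc) (trans (monicDisc-scale a b c (u a b c) (v a b c))
        (cong ⟦ genericMonicDisc ⟧ (vec₅ a≡ b≡ c≡ (sym (proj₁ cof)) (sym (proj₂ cof))))))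
      where
      cof : _ × _
      cof = cofactors {a} {b} {c} {A} {B} {C} a≡ b≡ c≡

  -- Affine Weierstrass points as roots of f

  P Q : Poly
  P = Pmonic5 p
  Q = Qdeg2 q

  WP : Pt → Set
  WP = IsWeierstrassPt (eqn p q)

  twice : ∀ {x y} → WP (just (x , y)) → y + y ≡ - eval Q x
  twice {x} {y} (_ , fixed) = trans (cong (_+ y) (sym (cong proj₂ (just-injective fixed))))
    (S.solve 2 (λ y s → (:- y :+ :- s) :+ y S.:= :- s) refl y (eval Q x))

  -- On the curve 4P + Q² = (2y + Q)², and a fixed point of the involution has 2y = - Q(x).
  wp-root : ∀ {x y} → WP (just (x , y)) → value eq x ≡ 0ℚ
  wp-root {x} {y} wp@(on , _) = begin
    value eq x                                     ≡⟨ polynomial-identity (horner (completeSquare (var 0F) (var 1F) (var 2F) (var 3F) (var 4F) (var 5F) (var 6F) (var 7F)) X)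
                                                        (κ 4 :* Pₚ :+ Qₚ :* Qₚ) refl (toℚ p₀ ∷ toℚ p₁ ∷ toℚ p₂ ∷ toℚ p₃ ∷ toℚ p₄ ∷ toℚ q₀ ∷ toℚ q₁ ∷ toℚ q₂ ∷ x ∷ []) ⟩
    toℚ (+ 4) * eval P x + s * s                   ≡⟨ cong (λ t → toℚ (+ 4) * t + s * s) (sym on) ⟩
    toℚ (+ 4) * (y * y + s * y) + s * s            ≡⟨ S.solve 2 (λ y s → κ 4 :* (y :* y :+ s :* y) :+ s :* s S.:= (y :+ y :+ s) :* (y :+ y :+ s)) refl y s ⟩
    (y + y + s) * (y + y + s)                      ≡⟨ cong (λ t → (t + s) * (t + s)) (twice wp) ⟩
    (- s + s) * (- s + s)                          ≡⟨ cong (λ t → t * t) (ℚ.+-inverseˡ s) ⟩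
    0ℚ * 0ℚ                                        ≡⟨⟩
    0ℚ                                             ∎
    where
    open ≡-Reasoning
    s : ℚ
    s = eval Q x
    X Pₚ Qₚ : Polynomial 9
    X = var 8F
    Pₚ = var 0F :+ X :* (var 1F :+ X :* (var 2F :+ X :* (var 3F :+ X :* (var 4F :+ X :* (κ 1 :+ X :* κ 0)))))
    Qₚ = var 5F :+ X :* (var 6F :+ X :* (var 7F :+ X :* κ 0))

  -- A Weierstrass point is determined by x, since 2y = - Q(x).
  wp-distinct : ∀ {x y x′ y′} → WP (just (x , y)) → WP (just (x′ , y′)) → just (x , y) ≢ just (x′ , y′) → x ≢ x′
  wp-distinct {x} {y} {_} {y′} wp wp′ ≢ refl = ≢ (cong (λ t → just (x , t)) (halve (trans (twice wp) (sym (twice wp′)))))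
    where
    halve : y + y ≡ y′ + y′ → y ≡ y′
    halve eq = trans (S.solve 2 (λ y z → y S.:= (y :- z) :+ z) refl y y′) (trans (cong (_+ y′) y-y′≡0) (ℚ.+-identityˡ y′))
      where
      y-y′≡0 : y + - y′ ≡ 0ℚ
      y-y′≡0 = ℚ-cancel {toℚ (+ 2)} (λ ()) (trans (S.solve 2 (λ y z → κ 2 :* (y :- z) S.:= (y :+ y) :- (z :+ z)) refl y y′)
        (trans (cong (λ t → t + - (y′ + y′)) eq) (ℚ.+-inverseʳ (y′ + y′))))

  three-roots : ∀ {P₁ P₂ P₃} → WP (just P₁) → WP (just P₂) → WP (just P₃) →
    just P₁ ≢ just P₂ → just P₁ ≢ just P₃ → just P₂ ≢ just P₃ → Roots
  three-roots {x₁ , y₁} {x₂ , y₂} {x₃ , y₃} w₁ w₂ w₃ d₁₂ d₁₃ d₂₃ = roots {x₁} {x₂} {x₃}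
    (wp-distinct w₁ w₂ d₁₂) (wp-distinct w₁ w₃ d₁₃) (wp-distinct w₂ w₃ d₂₃)
    (wp-root {x₁} {y₁} w₁) (wp-root {x₂} {y₂} w₂) (wp-root {x₃} {y₃} w₃)

  -- Distinct points include the one at infinity at most once, so three affine ones can always be
  -- chosen.
  pick : ∀ W₀ W₁ W₂ W₃ → WP W₀ → WP W₁ → WP W₂ → WP W₃ →
    W₀ ≢ W₁ → W₀ ≢ W₂ → W₀ ≢ W₃ → W₁ ≢ W₂ → W₁ ≢ W₃ → W₂ ≢ W₃ → Roots
  pick (just _) (just _) (just _) _        w₀ w₁ w₂ w₃ d₀₁ d₀₂ d₀₃ d₁₂ d₁₃ d₂₃ = three-roots w₀ w₁ w₂ d₀₁ d₀₂ d₁₂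
  pick (just _) (just _) nothing  (just _) w₀ w₁ w₂ w₃ d₀₁ d₀₂ d₀₃ d₁₂ d₁₃ d₂₃ = three-roots w₀ w₁ w₃ d₀₁ d₀₃ d₁₃
  pick (just _) nothing  (just _) (just _) w₀ w₁ w₂ w₃ d₀₁ d₀₂ d₀₃ d₁₂ d₁₃ d₂₃ = three-roots w₀ w₂ w₃ d₀₂ d₀₃ d₂₃
  pick nothing  (just _) (just _) (just _) w₀ w₁ w₂ w₃ d₀₁ d₀₂ d₀₃ d₁₂ d₁₃ d₂₃ = three-roots w₁ w₂ w₃ d₁₂ d₁₃ d₂₃
  pick nothing  nothing  _        _        w₀ w₁ w₂ w₃ d₀₁ d₀₂ d₀₃ d₁₂ d₁₃ d₂₃ = ⊥-elim (d₀₁ refl)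
  pick nothing  (just _) nothing  _        w₀ w₁ w₂ w₃ d₀₁ d₀₂ d₀₃ d₁₂ d₁₃ d₂₃ = ⊥-elim (d₀₂ refl)
  pick nothing  (just _) (just _) nothing  w₀ w₁ w₂ w₃ d₀₁ d₀₂ d₀₃ d₁₂ d₁₃ d₂₃ = ⊥-elim (d₀₃ refl)
  pick (just _) nothing  nothing  _        w₀ w₁ w₂ w₃ d₀₁ d₀₂ d₀₃ d₁₂ d₁₃ d₂₃ = ⊥-elim (d₁₂ refl)
  pick (just _) nothing  (just _) nothing  w₀ w₁ w₂ w₃ d₀₁ d₀₂ d₀₃ d₁₂ d₁₃ d₂₃ = ⊥-elim (d₁₃ refl)
  pick (just _) (just _) nothing  nothing  w₀ w₁ w₂ w₃ d₀₁ d₀₂ d₀₃ d₁₂ d₁₃ d₂₃ = ⊥-elim (d₂₃ refl)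

  rational-roots : ExactlyFourRatWP (eqn p q) → Roots
  rational-roots (W₀ ∷ W₁ ∷ W₂ ∷ W₃ ∷ [] , injective , _ , on) = pick W₀ W₁ W₂ W₃ (on 0F) (on 1F) (on 2F) (on 3F)
    (λ eq → case (injective 0F 1F eq)) (λ eq → case (injective 0F 2F eq)) (λ eq → case (injective 0F 3F eq))
    (λ eq → case (injective 1F 2F eq)) (λ eq → case (injective 1F 3F eq)) (λ eq → case (injective 2F 3F eq))
    where
    case : ∀ {i j : Fin 4} {i≢j : False (i ≟ j)} → i ≡ j → ⊥
    case {i≢j = i≢j} = toWitnessFalse i≢j

  not-odd-prime : ∀ {D ℓ} (r : Roots) → let open Roots r in
    toℚ (+ 256) * D ≡ ⟦ genericRootDisc ⟧ (a ∷ b ∷ c ∷ u a b c ∷ v a b c ∷ []) → Prime ℓ → 2 ∤ ℓ → ∣ D ∣ ≢ + ℓ / 1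
  not-odd-prime {D} {ℓ} r disc ℓ-prime 2∤ℓ ∣D∣≡ℓ = sign (ℚ.∣p∣≡p∨∣p∣≡-p D)
    where
    conclude : ∀ z → ℤ.∣ z ∣ ≡ ℓ → D ≡ toℚ z → ⊥
    conclude z refl D≡ = go (factors {D} {z} r disc D≡)
      where
      go : (∃ λ A → ∃ λ B → ∃ λ C → MonicFactors e z A B C) → ⊥
      go (A , B , C , F) = 2∤ℓ (even-disc-value p₀ p₁ p₂ p₃ p₄ q₀ q₁ q₂ F ℓ-prime)
    sign : ∣ D ∣ ≡ D ⊎ ∣ D ∣ ≡ - D → ⊥
    sign (inj₁ eq) = conclude (+ ℓ) refl (trans (sym eq) ∣D∣≡ℓ)
    sign (inj₂ eq) = conclude (ℤ.- (+ ℓ)) (ℤ.∣-i∣≡∣i∣ (+ ℓ)) (trans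
      (S.solve 1 (λ d → d S.:= :- (:- d)) refl D) (trans (cong -_ (trans (sym eq) ∣D∣≡ℓ)) (sym (toℚ-neg (+ ℓ)))))

theorem3 : (p : Vec ℤ 5) (q : Vec ℤ 3) →
    Δ (eqn p q) ≢ 0ℚ →
    ExactlyFourRatWP (eqn p q) →
    ((ℓ : ℕ) → Prime ℓ → MinimalAt ℓ (eqn p q)) →
    (ℓ : ℕ) → Prime ℓ → ¬ (2 ∣ ℓ) → ∣ Δ (eqn p q) ∣ ≢ (+ ℓ) / 1
theorem3 p@(p₀ ∷ p₁ ∷ p₂ ∷ p₃ ∷ p₄ ∷ []) q@(q₀ ∷ q₁ ∷ q₂ ∷ []) _ four _ ℓ ℓ-prime 2∤ℓ =
  not-odd-prime {Δ (eqn p q)} r (Δ-roots p q a≢b a≢c b≢c fa fb fc) ℓ-prime 2∤ℓ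
  where
  open Curve p₀ p₁ p₂ p₃ p₄ q₀ q₁ q₂ hiding (p; q)
  r : Roots
  r = rational-roots four
  open Roots r
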